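{- For every positive integer $n$, every $n$-vertex $\{K_4^{3- }, F_5\}$-free $3$-graph $\mathcal{H}$ with $\delta(\mathcal{H}) > \frac{4n^2}{45}$ is $3$-partite.
   Context: A $3$-graph is a collection $\mathcal{H}$ of $3$-element subsets (edges) of a finite vertex set $V(\mathcal{H})$. The degree of a vertex $v$ is the number of edges containing $v$, and $\delta(\mathcal{H})$ is the minimum degree. $K_4^{3- }$ is the $3$-graph on $\{a,b,c,d\}$ with edge set $\{abc, abd, acd\}$, and $F_5$ is the $3$-graph on $\{a,b,c,d,e\}$ with edge set $\{abc, abd, cde\}$; $\mathcal{H}$ is $\{K_4^{3- },F_5\}$-free if it contains no subgraph isomorphic to $K_4^{3- }$ or to $F_5$. $\mathcal{H}$ is $3$-partite if $V(\mathcal{H})$ can be partitioned into three sets such that every edge of $\mathcal{H}$ contains exactly one vertex from each set. -}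

module Defs where

open import Data.Nat using (ℕ; _<ᵇ_)
open import Data.Fin using (Fin; toℕ)
open import Data.Bool using (Bool; true; false; _∧_)
open import Data.List using (List; allFin; filterᵇ; length; concatMap; map)
open import Data.Product using (_×_; _,_; ∃-syntax; Σ-syntax)
open import Relation.Binary.PropositionalEquality using (_≡_; _≢_)
open import Relation.Nullary using (¬_)

-- A 3-graph on the vertex set Fin n: edges are 3-element subsets {a,b,c},
-- encoded by a Boolean membership function on triples that is invariant
-- under permutations and only true on triples of distinct vertices.
record ThreeGraph (n : ℕ) : Set where
  field
    edge     : Fin n → Fin n → Fin n → Bool
    sym₁₂    : ∀ a b c → edge a b c ≡ edge b a c
    sym₂₃    : ∀ a b c → edge a b c ≡ edge a c b
    distinct : ∀ a b c → edge a b c ≡ true → (a ≢ b) × (b ≢ c) × (a ≢ c)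
open ThreeGraph public

IsEdge : ∀ {n} → ThreeGraph n → Fin n → Fin n → Fin n → Set
IsEdge H a b c = edge H a b c ≡ true

-- degree of v: number of edges containing v, i.e. the number of unordered
-- pairs {u,w} (counted once via toℕ u < toℕ w) with {v,u,w} an edge
degree : ∀ {n} → ThreeGraph n → Fin n → ℕ
degree {n} H v =
  length (filterᵇ (λ p → pairOk p)
    (concatMap (λ u → map (λ w → (u , w)) (allFin n)) (allFin n)))
  where
  pairOk : Fin n × Fin n → Bool
  pairOk (u , w) = (toℕ u <ᵇ toℕ w) ∧ edge H v u w

ContainsK4minus : ∀ {n} → ThreeGraph n → Set
ContainsK4minus {n} H =
  ∃[ a ] ∃[ b ] ∃[ c ] ∃[ d ]
    (a ≢ b × a ≢ c × a ≢ d × b ≢ c × b ≢ d × c ≢ d)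
    × IsEdge H a b c × IsEdge H a b d × IsEdge H a c d

ContainsF5 : ∀ {n} → ThreeGraph n → Set
ContainsF5 {n} H =
  ∃[ a ] ∃[ b ] ∃[ c ] ∃[ d ] ∃[ e ]
    (a ≢ b × a ≢ c × a ≢ d × a ≢ e × b ≢ c × b ≢ d × b ≢ e
       × c ≢ d × c ≢ e × d ≢ e)
    × IsEdge H a b c × IsEdge H a b d × IsEdge H c d e

K4minusF5Free : ∀ {n} → ThreeGraph n → Set
K4minusF5Free H = ¬ ContainsK4minus H × ¬ ContainsF5 H

ThreePartite : ∀ {n} → ThreeGraph n → Set
ThreePartite {n} H =
  Σ[ part ∈ (Fin n → Fin 3) ] (∀ a b c → IsEdge H a b c →
    (part a ≢ part b) × (part b ≢ part c) × (part a ≢ part c))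

{-# OPTIONS --safe #-}
module Submission where

-- Being {K₄⁻, F₅}-free means that two vertices completing the same pair to an edge lie in no common
-- edge. Hence the links of the vertices of a clique of the shadow G are disjoint; as each link has
-- more than 4n²/45 edges, Turán's theorem excludes cliques on six, then five, then four vertices
-- (for a 4-clique, the union of its four links is itself K₄-free).
--
-- So G is K₄-free and every vertex lies in more than 4n²/45 triangles; we may add edges to G while
-- it stays K₄-free. If non-adjacency is then transitive, G is complete 3-partite. Otherwise G
-- contains a (possibly degenerate) Moser spindle; all degrees exceed 4n/7, so some vertex is joined
-- to five of its seven vertices and is the hub of a 5-wheel.
--
-- Let v be the hub, X = N(v), ξ = |X|, Y the rest, h the minimum degree of G[X], and choose the rim
-- with maximal degree sum in G[X]. Every vertex of X sees at most two rim vertices, which bounds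
-- the link of v by 5 e(X) ≤ ξ² + (2ξ − 5h)². A maximal matching of G[Y] with μ edges, η = |Y| − μ,
-- bounds the link of u ∈ X by (deg_X u + μ) η and the sum of the rim links by (2ξ + 4μ) η. If every
-- link has more than 4n²/45 edges, these bounds are contradictory; they are all tight for an
-- independent set of n/3 vertices joined to a balanced blow-up of the 5-cycle.

open import Defs
open import Data.Bool using (Bool; true; false; _∧_; _∨_; not; T; T?)
open import Data.Bool.Properties using (¬-not; ∧-zeroʳ; not-involutive) renaming (_≟_ to _≟ᵇ_)
open import Data.Empty using (⊥; ⊥-elim)
open import Data.Fin using (Fin; zero; suc; toℕ)
import Data.Fin as Fin
open import Data.Fin.Patterns using (0F; 1F; 2F; 3F; 4F; 5F; 6F)
open import Data.Fin.Permutation using (permutation)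
open import Data.Fin.Properties using (_≟_; any?; pigeonhole; suc-injective)
open import Data.List using (List; length; filterᵇ; concatMap; map; tabulate; allFin)
open import Data.List.Properties using (filter-++; length-++)
open import Data.Product using (Σ-syntax; _×_; _,_; ∃; ∃-syntax; proj₁; proj₂)
open import Data.Sum using (_⊎_; inj₁; inj₂; [_,_]′)
import Data.Vec.Functional as Vector
open import Function using (_∘_; id; flip)
open import Relation.Binary.PropositionalEquality
open import Relation.Nullary using (¬_; Dec; yes; no; ⌊_⌋; does)
open import Relation.Nullary.Decidable using (_×-dec_; _⊎-dec_; ¬?; dec-true; decidable-stable)

-- The polynomial inequalities that rule out a wheel

module IntegerInequalities where
  open import Data.Integer using (ℤ; +_; -_; _+_; _*_; _-_; _≤_; -[1+_]; 0ℤ; +≤+)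
  import Data.Integer.Properties as ℤ
  open import Data.Integer.Tactic.RingSolver using (solve-∀)
  import Data.Nat as ℕ
  open ℕ using (ℕ)

  infixl 6 _⊕_
  infixl 7 _⊗_

  _⊕_ : ∀ {a b} → 0ℤ ≤ a → 0ℤ ≤ b → 0ℤ ≤ a + b
  _⊕_ = ℤ.+-mono-≤

  _⊗_ : ∀ {a b} → 0ℤ ≤ a → 0ℤ ≤ b → 0ℤ ≤ a * b
  _⊗_ {+ a} {+ b} _ _ = subst (0ℤ ≤_) (ℤ.pos-* a b) (+≤+ ℕ.z≤n)

  square : ∀ a → 0ℤ ≤ a * a
  square (+ a)    = _⊗_ {+ a} {+ a} (+≤+ ℕ.z≤n) (+≤+ ℕ.z≤n)
  square -[1+ a ] = +≤+ ℕ.z≤n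

  lit : ∀ k → 0ℤ ≤ + k
  lit k = +≤+ ℕ.z≤n

  sign : ∀ a → 0ℤ ≤ a ⊎ 0ℤ ≤ - a
  sign (+ a)    = inj₁ (+≤+ ℕ.z≤n)
  sign -[1+ a ] = inj₂ (+≤+ ℕ.z≤n)

  -- The negation is weakened to `0ℤ ≤ - a`. This suffices because each certificate below is a sum
  -- of nonnegative terms that equals a negative constant, left over from the `- + 1` of the strict
  -- hypotheses.
  by-contradiction : ∀ a → (0ℤ ≤ - a → ⊥) → 0ℤ ≤ a
  by-contradiction a absurdity = [ id , ⊥-elim ∘ absurdity ]′ (sign a)

  absurd : ∀ {a k} → 0ℤ ≤ a → a ≡ -[1+ k ] → ⊥
  absurd () refl

  infer : ∀ {a b} → 0ℤ ≤ a → a ≡ b → 0ℤ ≤ b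
  infer p refl = p

  -- In units with N = 2n = 1: A measures how far the hub degree falls short of 2n/3, M the size of the
  -- matching, and e the irregularity of the link of the hub; all three vanish for the extremal graph.
  module _ (N A M e : ℤ)
    (N≥0 : 0ℤ ≤ N) (M≥0 : 0ℤ ≤ M) (e≥0 : 0ℤ ≤ e) (N+A≥M : 0ℤ ≤ N + A - M) (2N≥A : 0ℤ ≤ + 2 * N - A)
    (N+A≥2M : 0ℤ ≤ N + A - + 2 * M)
    (link-v : 0ℤ ≤ e * e - A * (+ 4 * N - A) - + 1)
    (link-u : 0ℤ ≤ (N + A - M) * (+ 4 * N - + 2 * A - e + + 5 * M) - + 4 * (N * N) - + 1)
    (link-rim : 0ℤ ≤ A * (N - A + + 3 * M) - + 2 * (M * M) - + 1)
    (mantel : 0ℤ ≤ + 5 * ((+ 2 * N - A) * (+ 2 * N - A)) - + 16 * (N * N) - + 1) where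

    private
      -- For A ≤ 0 the leading product of `link-rim` is at most 0, yet it must exceed 2 M².
      A≥0 : 0ℤ ≤ A
      A≥0 = by-contradiction A λ q →
        absurd {k = 0} (link-rim ⊕ q ⊗ (N≥0 ⊕ q ⊕ lit 3 ⊗ M≥0) ⊕ lit 2 ⊗ square M) (identity N A M)
        where
        identity : ∀ N A M → A * (N - A + + 3 * M) - + 2 * (M * M) - + 1 + - A * (N + - A + + 3 * M) + + 2 * (M * M) ≡ -[1+ 0 ]
        identity = solve-∀

      -- link-u in factored form; its defect 4 (A − M)² is what keeps e below 3 A + N / 16.
      link-u′ : 0ℤ ≤ (N + A - M) * (M + + 2 * A - e) - + 4 * ((A - M) * (A - M)) - + 1
      link-u′ = infer link-u (identity N A M e)
        where
        identity : ∀ N A M e → (N + A - M) * (+ 4 * N - + 2 * A - e + + 5 * M) - + 4 * (N * N) - + 1 ≡ (N + A - M) * (M + + 2 * A - e) - + 4 * ((A - M) * (A - M)) - + 1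
        identity = solve-∀

      -- By `link-u′` the product (N + A - M)(M + 2A - e) is positive, and its first factor is
      -- nonnegative.
      e≤M+2A : 0ℤ ≤ M + + 2 * A - e
      e≤M+2A = by-contradiction (M + + 2 * A - e) λ q → absurd {k = 0} (link-u′ ⊕ N+A≥M ⊗ q ⊕ lit 4 ⊗ square (A - M)) (identity N A M e)
        where
        identity : ∀ N A M e → (N + A - M) * (M + + 2 * A - e) - + 4 * ((A - M) * (A - M)) - + 1 + (N + A - M) * (- (M + + 2 * A - e)) + + 4 * ((A - M) * (A - M)) ≡ -[1+ 0 ]
        identity = solve-∀

      -- Start from 4AN - A² < e² ≤ (M + 2A)². The rim bound 2M² < A (N - A + 3M) removes M², then
      -- 2M ≤ N + A removes M, which leaves 3AN < 29A².
      3N≤29A : 0ℤ ≤ + 29 * A - + 3 * N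
      3N≤29A = by-contradiction (+ 29 * A - + 3 * N) λ q → absurd {k = 5}
          (lit 4 ⊗ (link-v ⊕ e≤M+2A ⊗ (M≥0 ⊕ lit 2 ⊗ A≥0 ⊕ e≥0)) ⊕ lit 2 ⊗ link-rim ⊕ lit 11 ⊗ (A≥0 ⊗ N+A≥2M) ⊕ A≥0 ⊗ q)
          (identity N A M e)
        where
        identity : ∀ N A M e →
          + 4 * (e * e - A * (+ 4 * N - A) - + 1 + (M + + 2 * A - e) * (M + + 2 * A + e)) + + 2 * (A * (N - A + + 3 * M) - + 2 * (M * M) - + 1)
          + + 11 * (A * (N + A - + 2 * M)) + A * (- (+ 29 * A - + 3 * N)) ≡ -[1+ 5 ]
        identity = solve-∀

      -- For A ≥ N/4 the leading term of `mantel` is at most 5 (7N/4)² = 245 N² / 16 ≤ 16 N².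
      4A≤N : 0ℤ ≤ N - + 4 * A
      4A≤N = by-contradiction (N - + 4 * A) λ q → absurd {k = 15}
          (lit 16 ⊗ mantel ⊕ lit 5 ⊗ (q ⊗ (lit 7 ⊗ N≥0 ⊕ lit 4 ⊗ 2N≥A)) ⊕ lit 11 ⊗ square N) (identity N A)
        where
        identity : ∀ N A → + 16 * (+ 5 * ((+ 2 * N - A) * (+ 2 * N - A)) - + 16 * (N * N) - + 1)
          + + 5 * ((- (N - + 4 * A)) * (+ 7 * N + + 4 * (+ 2 * N - A))) + + 11 * (N * N) ≡ -[1+ 15 ]
        identity = solve-∀

      -- For M ≤ A even e ≤ 3A. Otherwise put d = M - A: `link-u′` gives N (3A - e) > 4d² - Nd, and
      -- 4d² - Nd ≥ - N²/16 by completing the square.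
      16e≤48A+N : 0ℤ ≤ + 48 * A + N - + 16 * e
      16e≤48A+N = [ when-M≤A , when-A≤M ]′ (sign (A - M))
        where
        when-M≤A : 0ℤ ≤ A - M → 0ℤ ≤ + 48 * A + N - + 16 * e
        when-M≤A p = infer (lit 16 ⊗ e≤M+2A ⊕ lit 16 ⊗ p ⊕ N≥0) (identity N A M e)
          where
          identity : ∀ N A M e → + 16 * (M + + 2 * A - e) + + 16 * (A - M) + N ≡ + 48 * A + N - + 16 * e
          identity = solve-∀
        when-A≤M : 0ℤ ≤ - (A - M) → 0ℤ ≤ + 48 * A + N - + 16 * e
        when-A≤M p = by-contradiction (+ 48 * A + N - + 16 * e) λ q → absurd {k = 15}
          (lit 16 ⊗ link-u′ ⊕ lit 16 ⊗ (p ⊗ e≤M+2A) ⊕ square (+ 8 * (A - M) + N) ⊕ N≥0 ⊗ q) (identity N A M e)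
          where
          identity : ∀ N A M e → + 16 * ((N + A - M) * (M + + 2 * A - e) - + 4 * ((A - M) * (A - M)) - + 1)
            + + 16 * (- (A - M) * (M + + 2 * A - e)) + (+ 8 * (A - M) + N) * (+ 8 * (A - M) + N)
            + N * - (+ 48 * A + N - + 16 * e) ≡ -[1+ 15 ]
          identity = solve-∀

    -- Scaled to N = 1, `link-v` and the bound on e give A (4 - A) < (3A + 1/16)², that is 928A -
    -- 2560A² < 1. But 4A ≤ 1 makes the left side at least 288A, which exceeds 1 because 29A ≥ 3.
    links-incompatible : ⊥
    links-incompatible = absurd {k = 255}
      (lit 256 ⊗ link-v ⊕ 16e≤48A+N ⊗ (lit 48 ⊗ A≥0 ⊕ N≥0 ⊕ lit 16 ⊗ e≥0) ⊕ lit 640 ⊗ (A≥0 ⊗ 4A≤N)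
        ⊕ lit 9 ⊗ (N≥0 ⊗ 3N≤29A) ⊕ lit 26 ⊗ square N ⊕ lit 27 ⊗ (A≥0 ⊗ N≥0)) (identity N A M e)
      where
      identity : ∀ N A M e → + 256 * (e * e - A * (+ 4 * N - A) - + 1) + (+ 48 * A + N - + 16 * e) * (+ 48 * A + N + + 16 * e)
        + + 640 * (A * (N - + 4 * A)) + + 9 * (N * (+ 29 * A - + 3 * N)) + + 26 * (N * N) + + 27 * (A * N) ≡ -[1+ 255 ]
      identity = solve-∀

  -- Reifies the embedding of ℕ in ℤ: `:+` and `:*` build the integer image of an expression along
  -- its syntax.
  Cast : ℕ → ℤ → Set
  Cast k z = + k ≡ z

  var : ∀ k → Cast k (+ k)
  var k = refl

  infixl 6 _:+_
  infixl 7 _:*_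

  _:+_ : ∀ {k l y z} → Cast k y → Cast l z → Cast (k ℕ.+ l) (y + z)
  _:+_ {k} {l} refl refl = ℤ.pos-+ k l

  _:*_ : ∀ {k l y z} → Cast k y → Cast l z → Cast (k ℕ.* l) (y * z)
  _:*_ {k} {l} refl refl = ℤ.pos-* k l

  cast-≤ : ∀ {k l y z} → Cast k y → Cast l z → k ℕ.≤ l → 0ℤ ≤ z - y
  cast-≤ refl refl k≤l = ℤ.i≤j⇒0≤j-i (+≤+ k≤l)

  cast-< : ∀ {k l y z} → Cast k y → Cast l z → k ℕ.< l → 0ℤ ≤ z - y - + 1
  cast-< {k} {y = y} {z} refl refl k<l = infer (cast-≤ refl refl k<l) (trans (cong (λ w → z - w) (ℤ.pos-+ 1 k)) (identity (+ k) z))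
    where
    identity : ∀ y z → z - (+ 1 + y) ≡ z - y - + 1
    identity = solve-∀

  solve-for : ∀ {a b c : ℤ} → a + b ≡ c → a ≡ c - b
  solve-for {a} {b} refl = identity a b
    where
    identity : ∀ a b → a ≡ a + b - b
    identity = solve-∀

  -- `m` counts matched vertices, so m = 2μ, and `K` = 2η in terms of the matching.
  module _ (n ξ h K m E : ℕ) (E-def : E ℕ.+ 5 ℕ.* h ≡ 2 ℕ.* ξ) (K-def : K ℕ.+ (m ℕ.+ 2 ℕ.* ξ) ≡ 2 ℕ.* n)
    (m+ξ≤n : m ℕ.+ ξ ℕ.≤ n)
    (link-v : 4 ℕ.* (n ℕ.* n) ℕ.< 9 ℕ.* (ξ ℕ.* ξ ℕ.+ E ℕ.* E))
    (link-u : 16 ℕ.* (n ℕ.* n) ℕ.< 45 ℕ.* (K ℕ.* (2 ℕ.* h ℕ.+ m)))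
    (link-rim : 4 ℕ.* (n ℕ.* n) ℕ.< 9 ℕ.* (K ℕ.* (ξ ℕ.+ m)))
    (mantel : 16 ℕ.* (n ℕ.* n) ℕ.< 45 ℕ.* (ξ ℕ.* ξ)) where

    private
      E-cast : Cast E (+ 2 * + ξ - + 5 * + h)
      E-cast = solve-for (trans (sym (var E :+ var 5 :* var h)) (trans (cong +_ E-def) (var 2 :* var ξ)))

      K-cast : Cast K (+ 2 * + n - (+ m + + 2 * + ξ))
      K-cast = solve-for (trans (sym (var K :+ (var m :+ var 2 :* var ξ))) (trans (cong +_ K-def) (var 2 :* var n)))

      nn : Cast (n ℕ.* n) (+ n * + n)
      nn = var n :* var n

      nonneg : ∀ {k z} → Cast k z → 0ℤ ≤ z
      nonneg refl = +≤+ ℕ.z≤n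

      e-cast : Cast (6 ℕ.* E) (+ 6 * (+ 2 * + ξ - + 5 * + h))
      e-cast = var 6 :* E-cast

    parameters-incompatible : ⊥
    -- A = 6 (2n/3 - ξ), M = 6μ and e = 6E are the deviations from the extremal graph, scaled to be
    -- integers.
    parameters-incompatible = links-incompatible (+ 2 * + n) (+ 4 * + n - + 6 * + ξ) (+ 3 * + m) (+ 6 * (+ 2 * + ξ - + 5 * + h))
      (lit 2 ⊗ lit n) (lit 3 ⊗ lit m) (nonneg e-cast)
      (infer (lit 3 ⊗ nonneg K-cast) (id₁ (+ n) (+ ξ) (+ m)))
      (infer (lit 6 ⊗ lit ξ) (id₂ (+ n) (+ ξ)))
      (infer (lit 6 ⊗ cast-≤ (var m :+ var ξ) (var n) m+ξ≤n) (id₃ (+ n) (+ ξ) (+ m)))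
      -- Scaling by 4 turns the slack 1 of a strict inequality into 4; adding 3 brings it back to 1.
      (infer (lit 4 ⊗ cast-< (var 4 :* nn) (var 9 :* (var ξ :* var ξ :+ E-cast :* E-cast)) link-v ⊕ lit 3) (id₄ (+ n) (+ ξ) (+ h)))
      (infer (cast-< (var 16 :* nn) (var 45 :* (K-cast :* (var 2 :* var h :+ var m))) link-u) (id₅ (+ n) (+ ξ) (+ h) (+ m)))
      (infer (lit 2 ⊗ cast-< (var 4 :* nn) (var 9 :* (K-cast :* (var ξ :+ var m))) link-rim ⊕ lit 1) (id₆ (+ n) (+ ξ) (+ m)))
      (infer (lit 4 ⊗ cast-< (var 16 :* nn) (var 45 :* (var ξ :* var ξ)) mantel ⊕ lit 3) (id₇ (+ n) (+ ξ)))
      where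
      id₁ : ∀ n ξ m → + 3 * (+ 2 * n - (m + + 2 * ξ)) ≡ + 2 * n + (+ 4 * n - + 6 * ξ) - + 3 * m
      id₁ = solve-∀
      id₂ : ∀ n ξ → + 6 * ξ ≡ + 2 * (+ 2 * n) - (+ 4 * n - + 6 * ξ)
      id₂ = solve-∀
      id₃ : ∀ n ξ m → + 6 * (n - (m + ξ)) ≡ + 2 * n + (+ 4 * n - + 6 * ξ) - + 2 * (+ 3 * m)
      id₃ = solve-∀
      id₄ : ∀ n ξ h → + 4 * (+ 9 * (ξ * ξ + (+ 2 * ξ - + 5 * h) * (+ 2 * ξ - + 5 * h)) - + 4 * (n * n) - + 1) + + 3
        ≡ + 6 * (+ 2 * ξ - + 5 * h) * (+ 6 * (+ 2 * ξ - + 5 * h)) - (+ 4 * n - + 6 * ξ) * (+ 4 * (+ 2 * n) - (+ 4 * n - + 6 * ξ)) - + 1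
      id₄ = solve-∀
      id₅ : ∀ n ξ h m → + 45 * ((+ 2 * n - (m + + 2 * ξ)) * (+ 2 * h + m)) - + 16 * (n * n) - + 1
        ≡ (+ 2 * n + (+ 4 * n - + 6 * ξ) - + 3 * m) * (+ 4 * (+ 2 * n) - + 2 * (+ 4 * n - + 6 * ξ) - + 6 * (+ 2 * ξ - + 5 * h) + + 5 * (+ 3 * m))
          - + 4 * (+ 2 * n * (+ 2 * n)) - + 1
      id₅ = solve-∀
      id₆ : ∀ n ξ m → + 2 * (+ 9 * ((+ 2 * n - (m + + 2 * ξ)) * (ξ + m)) - + 4 * (n * n) - + 1) + + 1
        ≡ (+ 4 * n - + 6 * ξ) * (+ 2 * n - (+ 4 * n - + 6 * ξ) + + 3 * (+ 3 * m)) - + 2 * (+ 3 * m * (+ 3 * m)) - + 1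
      id₆ = solve-∀
      id₇ : ∀ n ξ → + 4 * (+ 45 * (ξ * ξ) - + 16 * (n * n) - + 1) + + 3
        ≡ + 5 * ((+ 2 * (+ 2 * n) - (+ 4 * n - + 6 * ξ)) * (+ 2 * (+ 2 * n) - (+ 4 * n - + 6 * ξ))) - + 16 * (+ 2 * n * (+ 2 * n)) - + 1
      id₇ = solve-∀

open IntegerInequalities using (parameters-incompatible)
open import Data.Nat using (ℕ; zero; suc; _+_; _*_; _∸_; _≤_; _≥_; _<_; _≤ᵇ_; _≡ᵇ_; _<ᵇ_; _<?_; z≤n; s≤s; z<s; s<s)
open import Data.Nat.Properties hiding (_≟_; suc-injective)
open import Data.Nat.Tactic.RingSolver using (solve-∀)
open import Algebra.Properties.Semiring.Sum +-*-semiring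
  using (sum; sum-cong-≗; ∑-distrib-+; ∑-comm; sum-permute; *-distribˡ-sum; *-distribʳ-sum)

-- Finite sums and counting

private variable
  n k : ℕ

⟦_⟧ : Bool → ℕ
⟦ true ⟧ = 1
⟦ false ⟧ = 0

count : (Fin n → Bool) → ℕ
count S = sum (⟦_⟧ ∘ S)

sum-mono-≤ : {f g : Fin n → ℕ} → (∀ i → f i ≤ g i) → sum f ≤ sum g
sum-mono-≤ {zero}  f≤g = z≤n
sum-mono-≤ {suc n} f≤g = +-mono-≤ (f≤g zero) (sum-mono-≤ (f≤g ∘ suc))

sum-mono-< : {f g : Fin n → ℕ} → (∀ i → f i ≤ g i) → ∀ k → f k < g k → sum f < sum g
sum-mono-< f≤g zero    fk<gk = +-mono-<-≤ fk<gk (sum-mono-≤ (f≤g ∘ suc))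
sum-mono-< f≤g (suc k) fk<gk = +-mono-≤-< (f≤g zero) (sum-mono-< (f≤g ∘ suc) k fk<gk)

sum-const : ∀ n c → sum {n} (λ _ → c) ≡ n * c
sum-const zero    c = refl
sum-const (suc n) c = cong (c +_) (sum-const n c)

sum-scale : ∀ c (f : Fin n → ℕ) → sum (λ i → c * f i) ≡ c * sum f
sum-scale c f = sym (*-distribˡ-sum c f)

sum-zero : {f : Fin n → ℕ} → (∀ i → f i ≡ 0) → sum f ≡ 0
sum-zero {n} f≡0 = trans (sum-cong-≗ f≡0) (trans (sum-const n 0) (*-zeroʳ n))

∑∑ : (Fin n → Fin n → ℕ) → ℕ
∑∑ f = sum λ x → sum (f x)

∑∑-mono-≤ : {f g : Fin n → Fin n → ℕ} → (∀ x y → f x y ≤ g x y) → ∑∑ f ≤ ∑∑ g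
∑∑-mono-≤ f≤g = sum-mono-≤ λ x → sum-mono-≤ (f≤g x)

∑∑-+ : (f g : Fin n → Fin n → ℕ) → ∑∑ (λ x y → f x y + g x y) ≡ ∑∑ f + ∑∑ g
∑∑-+ f g = trans (sum-cong-≗ λ x → ∑-distrib-+ (f x) (g x)) (∑-distrib-+ (λ x → sum (f x)) (λ x → sum (g x)))

∑∑-zero : {f : Fin n → Fin n → ℕ} → (∀ x y → f x y ≡ 0) → ∑∑ f ≡ 0
∑∑-zero f≡0 = sum-zero λ x → sum-zero (f≡0 x)

count≤n : (S : Fin n → Bool) → count S ≤ n
count≤n {n} S = begin
  count S           ≤⟨ sum-mono-≤ (λ i → ⟦⟧≤1 (S i)) ⟩
  sum {n} (λ _ → 1) ≡⟨ sum-const n 1 ⟩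
  n * 1             ≡⟨ *-identityʳ n ⟩
  n                 ∎
  where
  open ≤-Reasoning
  ⟦⟧≤1 : ∀ b → ⟦ b ⟧ ≤ 1
  ⟦⟧≤1 true  = ≤-refl
  ⟦⟧≤1 false = z≤n

sum-positive : (f : Fin n → ℕ) → 0 < sum f → ∃[ i ] 0 < f i
sum-positive {suc n} f 0<∑ with f zero in eq
... | suc k = zero , subst (0 <_) (sym eq) z<s
... | zero  = let i , 0<fi = sum-positive (f ∘ suc) 0<∑ in suc i , 0<fi

⟦⟧-positive : ∀ {b} → 0 < ⟦ b ⟧ → b ≡ true
⟦⟧-positive {true} _ = refl

⟦⟧-mono : ∀ {a b} → (a ≡ true → b ≡ true) → ⟦ a ⟧ ≤ ⟦ b ⟧
⟦⟧-mono {false} _ = z≤n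
⟦⟧-mono {true} a⇒b rewrite a⇒b refl = ≤-refl

-- Booleans, truth tables and extremal choices

false≢true : false ≢ true
false≢true ()

∧-intro : ∀ {a b} → a ≡ true → b ≡ true → a ∧ b ≡ true
∧-intro refl refl = refl

∧-true : ∀ {a b} → a ∧ b ≡ true → a ≡ true × b ≡ true
∧-true {true} {true} _ = refl , refl

BoolFun : ℕ → Set
BoolFun zero    = Bool
BoolFun (suc k) = Bool → BoolFun k

tautology : ∀ k → BoolFun k → Bool
tautology zero    b = b
tautology (suc k) f = tautology k (f true) ∧ tautology k (f false)

Valid : ∀ k → BoolFun k → Set
Valid zero    b = T b
Valid (suc k) f = ∀ b → Valid k (f b)

-- For a closed `f` the premise reduces to the unit type during type checking, so `_` fills it and
-- the truth table is settled by computation.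
check : ∀ k (f : BoolFun k) → T (tautology k f) → Valid k f
check zero    b holds = holds
check (suc k) f holds b with tautology k (f true) in eq | tautology k (f false) in eq′
check (suc k) f holds true  | true | true = check k (f true) (subst T (sym eq) _)
check (suc k) f holds false | true | true = check k (f false) (subst T (sym eq′) _)

implies : ∀ {p q} → T (not p ∨ q) → p ≡ true → T q
implies {true} holds _ = holds

-- Stated for a total preorder so that `_≤_` yields a maximum and `_≥_` a minimum.
extremum : (_≼_ : ℕ → ℕ → Set) → (∀ {a} → a ≼ a) → (∀ {a b c} → a ≼ b → b ≼ c → a ≼ c) →
  (∀ a b → a ≼ b ⊎ b ≼ a) → (S : Fin n → Bool) (f : Fin n → ℕ) →
  (∀ x → ¬ S x ≡ true) ⊎ ∃[ x ] S x ≡ true × (∀ z → S z ≡ true → f z ≼ f x)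
extremum {zero} _≼_ rfl trs tot S f = inj₁ λ ()
extremum {suc n} _≼_ rfl trs tot S f with S zero in eq | extremum _≼_ rfl trs tot (S ∘ suc) (f ∘ suc)
... | false | inj₁ none = inj₁ λ { zero S0 → false≢true (trans (sym eq) S0) ; (suc x) → none x }
... | false | inj₂ (x , Sx , ub) =
  inj₂ (suc x , Sx , λ { zero S0 → ⊥-elim (false≢true (trans (sym eq) S0)) ; (suc z) → ub z })
... | true | inj₁ none = inj₂ (zero , eq , λ { zero _ → rfl ; (suc z) Sz → ⊥-elim (none z Sz) })
... | true | inj₂ (x , Sx , ub) with tot (f zero) (f (suc x))
...   | inj₁ le = inj₂ (suc x , Sx , λ { zero _ → le ; (suc z) → ub z })
...   | inj₂ ge = inj₂ (zero , eq , λ { zero _ → rfl ; (suc z) Sz → trs (ub z Sz) ge })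

-- Hill climbing along a bounded potential; it produces maximal matchings, optimal rims and
-- saturated graphs.
ascend : {A : Set} (f : A → ℕ) (bound : ℕ) → (∀ a → f a ≤ bound) → {Stuck : A → Set} →
  (∀ a → (∃[ a′ ] f a < f a′) ⊎ Stuck a) → A → ∃ Stuck
ascend {A} f bound f≤bound {Stuck} step a₀ = go bound a₀ (m≤m+n bound (f a₀))
  where
  -- The fuel bounds the number of improvements still possible; at fuel 0 the potential has reached
  -- `bound`.
  go : ∀ fuel a → bound ≤ fuel + f a → ∃ Stuck
  go fuel a enough with step a
  ... | inj₂ stuck = a , stuck
  go zero a enough | inj₁ (a′ , fa<fa′) = ⊥-elim (<-irrefl refl (<-≤-trans fa<fa′ (≤-trans (f≤bound a′) enough)))
  go (suc fuel) a enough | inj₁ (a′ , fa<fa′) = go fuel a′ (≤-trans enough (≤-trans (≤-reflexive (sym (+-suc fuel (f a)))) (+-monoʳ-≤ fuel fa<fa′)))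

-- Turán's theorem

Relation : ℕ → Set
Relation n = Fin n → Fin n → Bool

neighbours : Relation n → (Fin n → Bool) → Fin n → Fin n → Bool
neighbours R S x y = S y ∧ R x y

deg : Relation n → (Fin n → Bool) → Fin n → ℕ
deg R S x = count (neighbours R S x)

-- Ordered pairs, so each edge inside S is counted twice.
pairs : Relation n → (Fin n → Bool) → ℕ
pairs R S = ∑∑ λ x y → ⟦ S x ∧ S y ∧ R x y ⟧

-- Clique number at most the index, by recursion on neighbourhoods to match the induction in
-- `turán`.
ω≤ : Relation n → ℕ → (Fin n → Bool) → Set
ω≤ R zero    S = ∀ x → ¬ S x ≡ true
ω≤ R (suc r) S = ∀ x → S x ≡ true → ω≤ R r (neighbours R S x)

empty⇒no-pairs : (R : Relation n) (S : Fin n → Bool) → (∀ x → ¬ S x ≡ true) → pairs R S ≡ 0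
empty⇒no-pairs R S none = ∑∑-zero λ x y → cong (λ b → ⟦ b ∧ S y ∧ R x y ⟧) (¬-not (none x))

module _ (R : Relation n) (R-sym : ∀ x y → R x y ≡ R y x) (S : Fin n → Bool) where

  private
    off : Fin n → Fin n → ℕ
    off v x = ⟦ S x ∧ not (R v x) ⟧

  -- An edge inside `S` lies in the neighbourhood of `v` or has an end off it. The latter are |S| -
  -- D vertices of degree at most D each, and both orientations of an edge are counted.
  pairs-split : ∀ v → (∀ z → S z ≡ true → deg R S z ≤ deg R S v) →
    pairs R S ≤ pairs R (neighbours R S v) + (count S ∸ deg R S v) * deg R S v + (count S ∸ deg R S v) * deg R S v
  pairs-split v ub = begin
    pairs R S
      ≤⟨ ∑∑-mono-≤ pointwise ⟩
    ∑∑ (λ x y → inner x y + from x y + from y x)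
      ≡⟨ trans (∑∑-+ (λ x y → inner x y + from x y) (λ x y → from y x)) (cong (_+ ∑∑ (λ x y → from y x)) (∑∑-+ inner from)) ⟩
    pairs R N + ∑∑ from + ∑∑ (λ x y → from y x)
      ≡⟨ cong (pairs R N + ∑∑ from +_) (∑-comm (λ x y → from y x)) ⟩
    pairs R N + ∑∑ from + ∑∑ from
      ≤⟨ +-mono-≤ (+-monoʳ-≤ (pairs R N) off-bound) off-bound ⟩
    pairs R N + (count S ∸ D) * D + (count S ∸ D) * D ∎
    where
    open ≤-Reasoning
    N = neighbours R S v
    D = deg R S v

    inner from : Fin n → Fin n → ℕ
    inner x y = ⟦ N x ∧ N y ∧ R x y ⟧
    from x y = off v x * ⟦ S y ∧ R x y ⟧

    pointwise : ∀ x y → ⟦ S x ∧ S y ∧ R x y ⟧ ≤ inner x y + from x y + from y x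
    pointwise x y rewrite R-sym y x = ≤ᵇ⇒≤ _ _ (check 5 (λ a b p q r →
      ⟦ a ∧ b ∧ r ⟧ ≤ᵇ ⟦ (a ∧ p) ∧ (b ∧ q) ∧ r ⟧ + ⟦ a ∧ not p ⟧ * ⟦ b ∧ r ⟧ + ⟦ b ∧ not q ⟧ * ⟦ a ∧ r ⟧) _
      (S x) (S y) (R v x) (R v y) (R x y))

    off-count : sum (off v) ≡ count S ∸ D
    off-count = sym (trans (cong (_∸ D) (trans (sum-cong-≗ split) (∑-distrib-+ (off v) _))) (m+n∸n≡m _ D))
      where
      split : ∀ x → ⟦ S x ⟧ ≡ off v x + ⟦ S x ∧ R v x ⟧
      split x with S x | R v x
      ... | true  | true  = refl
      ... | true  | false = refl
      ... | false | _     = refl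

    off-bound : ∑∑ from ≤ (count S ∸ D) * D
    off-bound = begin
      ∑∑ from                         ≡⟨ sum-cong-≗ (λ x → sum-scale (off v x) (λ y → ⟦ S y ∧ R x y ⟧)) ⟩
      sum (λ x → off v x * deg R S x)                   ≤⟨ sum-mono-≤ degree-bound ⟩
      sum (λ x → off v x * D)                           ≡⟨ *-distribʳ-sum D (off v) ⟨
      sum (off v) * D                                   ≡⟨ cong (_* D) off-count ⟩
      (count S ∸ D) * D                                 ∎
      where
      degree-bound : ∀ x → off v x * deg R S x ≤ off v x * D
      degree-bound x with S x in Sx
      ... | true  = *-monoʳ-≤ ⟦ not (R v x) ⟧ (ub x Sx)
      ... | false = z≤n

  deg≤count : ∀ x → deg R S x ≤ count S
  deg≤count x = sum-mono-≤ λ y → ≤ᵇ⇒≤ _ _ (check 2 (λ a b → ⟦ a ∧ b ⟧ ≤ᵇ ⟦ a ⟧) _ (S y) (R x y))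

2xy≤x²+y² : ∀ x y → x * y + x * y ≤ x * x + y * y
2xy≤x²+y² x y with ≤-total x y
... | inj₁ x≤y with k , refl ← m≤n⇒∃[o]m+o≡n x≤y = ≤-trans (m≤m+n _ (k * k)) (≤-reflexive (eq x k))
  where
  eq : ∀ x k → x * (x + k) + x * (x + k) + k * k ≡ x * x + (x + k) * (x + k)
  eq = solve-∀
2xy≤x²+y² x y | inj₂ y≤x with k , refl ← m≤n⇒∃[o]m+o≡n y≤x = ≤-trans (m≤m+n _ (k * k)) (≤-reflexive (eq y k))
  where
  eq : ∀ x k → (x + k) * x + (x + k) * x + k * k ≡ (x + k) * (x + k) + x * x
  eq = solve-∀

-- With r = q + 1 and s = D + k this amounts to (r s − (r + 1) D)² ≥ 0.
square-bound : ∀ q D k o p → suc q * p ≤ q * (D * D) → o ≤ p + k * D + k * D →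
  suc (suc q) * o ≤ suc q * ((D + k) * (D + k))
square-bound q D k o p IH split = *-cancelˡ-≤ (suc q) (begin
  suc q * (suc (suc q) * o)                                   ≤⟨ *-monoʳ-≤ (suc q) (*-monoʳ-≤ (suc (suc q)) split) ⟩
  suc q * (suc (suc q) * (p + k * D + k * D))                 ≡⟨ expand q D k p ⟩
  suc (suc q) * (suc q * p) + suc q * suc (suc q) * (k * D + k * D) ≤⟨ +-monoˡ-≤ _ (*-monoʳ-≤ (suc (suc q)) IH) ⟩
  suc (suc q) * (q * (D * D)) + suc q * suc (suc q) * (k * D + k * D) ≤⟨ complete-square ⟩
  suc q * (suc q * ((D + k) * (D + k)))                       ∎)
  where
  open ≤-Reasoning
  expand : ∀ q D k p → suc q * (suc (suc q) * (p + k * D + k * D)) ≡ suc (suc q) * (suc q * p) + suc q * suc (suc q) * (k * D + k * D)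
  expand = solve-∀
  complete-square : suc (suc q) * (q * (D * D)) + suc q * suc (suc q) * (k * D + k * D) ≤ suc q * (suc q * ((D + k) * (D + k)))
  complete-square = begin
    suc (suc q) * (q * (D * D)) + suc q * suc (suc q) * (k * D + k * D)
      ≡⟨ lhs q D k ⟩
    q * q * (D * D) + (q + q) * (D * D) + suc q * suc q * (k * D + k * D) + (suc q * k * D + suc q * k * D)
      ≤⟨ +-monoʳ-≤ (q * q * (D * D) + (q + q) * (D * D) + suc q * suc q * (k * D + k * D)) (2xy≤x²+y² (suc q * k) D) ⟩
    q * q * (D * D) + (q + q) * (D * D) + suc q * suc q * (k * D + k * D) + (suc q * k * (suc q * k) + D * D)
      ≡⟨ rhs q D k ⟩
    suc q * (suc q * ((D + k) * (D + k))) ∎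
    where
    lhs : ∀ q D k → suc (suc q) * (q * (D * D)) + suc q * suc (suc q) * (k * D + k * D) ≡ q * q * (D * D) + (q + q) * (D * D) + suc q * suc q * (k * D + k * D) + (suc q * k * D + suc q * k * D)
    lhs = solve-∀
    rhs : ∀ q D k → q * q * (D * D) + (q + q) * (D * D) + suc q * suc q * (k * D + k * D) + (suc q * k * (suc q * k) + D * D) ≡ suc q * (suc q * ((D + k) * (D + k)))
    rhs = solve-∀

-- Induction on the neighbourhood of a vertex v of maximal degree, where the clique number drops by
-- one; `pairs-split` pays for the vertices off it.
turán : (R : Relation n) → (∀ x y → R x y ≡ R y x) → ∀ r (S : Fin n → Bool) → ω≤ R (suc r) S →
  suc r * pairs R S ≤ r * (count S * count S)
turán R R-sym r S ω with extremum _≤_ ≤-refl ≤-trans ≤-total S (deg R S)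
... | inj₁ none = ≤-trans (≤-reflexive (trans (cong (suc r *_) (empty⇒no-pairs R S none)) (*-zeroʳ (suc r)))) z≤n
turán R R-sym zero S ω | inj₂ (v , Sv , ub) = ≤-reflexive (trans (*-identityˡ _) (∑∑-zero none))
  where
  none : ∀ x y → ⟦ S x ∧ S y ∧ R x y ⟧ ≡ 0
  none x y with S x in Sx
  ... | false = refl
  ... | true  = cong ⟦_⟧ (¬-not (ω x Sx y))
turán R R-sym (suc r) S ω | inj₂ (v , Sv , ub) =
  subst (λ s → suc (suc r) * pairs R S ≤ suc r * (s * s)) (m+[n∸m]≡n (deg≤count R R-sym S v))
    (square-bound r (deg R S v) (count S ∸ deg R S v) (pairs R S) (pairs R (neighbours R S v))
      (turán R R-sym r (neighbours R S v) (ω v Sv)) (pairs-split R R-sym S v ub))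

-- `no-K₄` ranges over all quadruples, so that a loop counts as a degenerate K₄ and irreflexivity
-- follows.
record K₄FreeGraph (n : ℕ) : Set where
  field
    adj      : Relation n
    adj-sym  : ∀ x y → adj x y ≡ adj y x
    no-K₄    : ∀ {a b c d} → adj a b ≡ true → adj a c ≡ true → adj a d ≡ true →
               adj b c ≡ true → adj b d ≡ true → adj c d ≡ true → ⊥

  infix 4 _∼_
  _∼_ : Fin n → Fin n → Set
  x ∼ y = adj x y ≡ true

  ∼-sym : ∀ {x y} → x ∼ y → y ∼ x
  ∼-sym {x} {y} x∼y = trans (adj-sym y x) x∼y

  irrefl : ∀ {x} → ¬ x ∼ x
  irrefl x∼x = no-K₄ x∼x x∼x x∼x x∼x x∼x x∼x

  -- Ordered pairs, so each triangle at `v` counts twice; hence the 8 in `Dense` where the theorem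
  -- has 4.
  triangles : Fin n → ℕ
  triangles v = pairs adj (adj v)

pairs-deg : (R : Relation n) (S : Fin n → Bool) → pairs R S ≡ sum (λ x → ⟦ S x ⟧ * deg R S x)
pairs-deg {n} R S = sum-cong-≗ row
  where
  row : ∀ x → sum (λ y → ⟦ S x ∧ S y ∧ R x y ⟧) ≡ ⟦ S x ⟧ * deg R S x
  row x with S x
  ... | true  = sym (*-identityˡ _)
  ... | false = sum-zero {n} {λ _ → 0} (λ _ → refl)

-- Matchings

module Matchings {n} (G : K₄FreeGraph n) (Y : Fin n → Bool) where
  open K₄FreeGraph G

  -- An involution that moves exactly the matched vertices: sums can be reindexed along `σ`, which
  -- brings the two ends of a matching edge together. `size` counts vertices, twice the number of
  -- edges.
  record Matching : Set where
    field
      σ             : Fin n → Fin n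
      involutive    : ∀ a → σ (σ a) ≡ a
      matched-edge  : ∀ a → σ a ≢ a → a ∼ σ a
      matched-∈     : ∀ a → σ a ≢ a → Y a ≡ true

    moved : Fin n → Bool
    moved a = not ⌊ σ a ≟ a ⌋

    size : ℕ
    size = count moved

    Maximal : Set
    Maximal = ∀ a b → Y a ≡ true → Y b ≡ true → σ a ≡ a → σ b ≡ b → ¬ a ∼ b

    reindex : (f : Fin n → ℕ) → sum f ≡ sum (f ∘ σ)
    reindex f = sum-permute f (permutation σ σ involutive involutive)

    moved-σ : ∀ a → moved (σ a) ≡ moved a
    moved-σ a with σ a ≟ a | σ (σ a) ≟ σ a
    ... | yes _   | yes _   = refl
    ... | no _    | no _    = refl
    ... | yes fix | no ¬fix = ⊥-elim (¬fix (cong σ fix))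
    ... | no ¬fix | yes fix = ⊥-elim (¬fix (trans (sym fix) (involutive a)))

    -- An independent subset of Y uses at most one vertex of each matched pair, so it has at most K / 2 vertices.
    κ : Fin n → ℕ
    κ a = ⟦ Y a ⟧ + ⟦ Y a ∧ not (moved a) ⟧

    κ+moved : ∀ a → κ a + ⟦ moved a ⟧ ≡ ⟦ Y a ⟧ + ⟦ Y a ⟧
    κ+moved a with σ a ≟ a
    ... | no ¬fix rewrite matched-∈ a ¬fix = refl
    ... | yes _ with Y a
    ...   | true  = refl
    ...   | false = refl

    K : ℕ
    K = sum κ

    moved≤Y : ∀ a → ⟦ moved a ⟧ ≤ ⟦ Y a ⟧
    moved≤Y a with σ a ≟ a
    ... | yes _   = z≤n
    ... | no ¬fix rewrite matched-∈ a ¬fix = ≤-refl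

    size≤ : size ≤ count Y
    size≤ = sum-mono-≤ moved≤Y

    K+size : K + size ≡ count Y + count Y
    K+size = begin
      K + size                     ≡⟨ ∑-distrib-+ κ (⟦_⟧ ∘ moved) ⟨
      sum (λ a → κ a + ⟦ moved a ⟧) ≡⟨ sum-cong-≗ κ+moved ⟩
      sum (λ a → ⟦ Y a ⟧ + ⟦ Y a ⟧) ≡⟨ ∑-distrib-+ (⟦_⟧ ∘ Y) (⟦_⟧ ∘ Y) ⟩
      count Y + count Y            ∎
      where open ≡-Reasoning

  open Matching

  private
    module Extend (M : Matching) {a b} (Ya : Y a ≡ true) (Yb : Y b ≡ true)
      (fixa : σ M a ≡ a) (fixb : σ M b ≡ b) (a∼b : a ∼ b) where

      τ : Fin n → Fin n
      τ z with z ≟ a | z ≟ b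
      ... | yes _ | _     = b
      ... | no _  | yes _ = a
      ... | no _  | no _  = σ M z

      b≢a : b ≢ a
      b≢a refl = irrefl a∼b

      τa : τ a ≡ b
      τa with a ≟ a
      ... | yes _  = refl
      ... | no a≢a = ⊥-elim (a≢a refl)

      τb : τ b ≡ a
      τb with b ≟ a | b ≟ b
      ... | yes b≡a | _      = ⊥-elim (b≢a b≡a)
      ... | no _    | yes _  = refl
      ... | no _    | no b≢b = ⊥-elim (b≢b refl)

      τ-other : ∀ {z} → z ≢ a → z ≢ b → τ z ≡ σ M z
      τ-other {z} z≢a z≢b with z ≟ a | z ≟ b
      ... | yes z≡a | _       = ⊥-elim (z≢a z≡a)
      ... | no _    | yes z≡b = ⊥-elim (z≢b z≡b)
      ... | no _    | no _    = refl

      preimage : ∀ {z w} → σ M w ≡ w → σ M z ≡ w → z ≡ w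
      preimage {z} fixw eq = trans (sym (involutive M z)) (trans (cong (σ M) eq) fixw)

      τ-involutive : ∀ z → τ (τ z) ≡ z
      τ-involutive z with z ≟ a | z ≟ b
      ... | yes refl | _        = τb
      ... | no _     | yes refl = τa
      ... | no z≢a   | no z≢b   =
        trans (τ-other (z≢a ∘ preimage fixa) (z≢b ∘ preimage fixb)) (involutive M z)

      extended : Matching
      extended .σ            = τ
      extended .involutive   = τ-involutive
      extended .matched-edge z τz≢z with z ≟ a | z ≟ b
      ... | yes refl | _        = a∼b
      ... | no _     | yes refl = ∼-sym a∼b
      ... | no _     | no _     = matched-edge M z τz≢z
      extended .matched-∈ z τz≢z with z ≟ a | z ≟ b
      ... | yes refl | _        = Ya
      ... | no _     | yes refl = Yb
      ... | no _     | no _     = matched-∈ M z τz≢z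

      larger : size M < size extended
      larger = sum-mono-< pointwise a strict
        where
        pointwise : ∀ z → ⟦ moved M z ⟧ ≤ ⟦ moved extended z ⟧
        pointwise z with σ M z ≟ z
        ... | yes _   = z≤n
        ... | no ¬fix with τ z ≟ z
        ...   | no _ = ≤-refl
        ...   | yes fix = ⊥-elim (¬fix (trans (sym (τ-other (λ { refl → ¬fix fixa }) (λ { refl → ¬fix fixb }))) fix))
        strict : ⟦ moved M a ⟧ < ⟦ moved extended a ⟧
        strict with σ M a ≟ a | τ a ≟ a
        ... | yes _   | no _    = z<s
        ... | yes _   | yes fix = ⊥-elim (b≢a (trans (sym τa) fix))
        ... | no ¬fix | _       = ⊥-elim (¬fix fixa)

  maximal-matching : Σ[ M ∈ Matching ] Maximal M
  maximal-matching = ascend size n (count≤n ∘ moved) improve trivial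
    where
    trivial : Matching
    trivial .σ a                = a
    trivial .involutive a       = refl
    trivial .matched-edge a a≢a = ⊥-elim (a≢a refl)
    trivial .matched-∈ a a≢a    = ⊥-elim (a≢a refl)

    improve : ∀ M → (∃[ M′ ] size M < size M′) ⊎ Maximal M
    improve M with any? (λ a → any? (λ b → (Y a ≟ᵇ true) ×-dec (Y b ≟ᵇ true) ×-dec (σ M a ≟ a) ×-dec (σ M b ≟ b) ×-dec (adj a b ≟ᵇ true)))
    ... | yes (a , b , Ya , Yb , fixa , fixb , a∼b) = inj₁ (extended , larger)
      where open Extend M Ya Yb fixa fixb a∼b
    ... | no none = inj₂ λ a b Ya Yb fixa fixb a∼b → none (a , b , Ya , Yb , fixa , fixb , a∼b)

  -- A common frame for `link-in-X` and `rim-links`, where `g x z` counts the links, of `u` or of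
  -- rim vertices, that contain xz.
  module _ (M : Matching) (g : Fin n → Fin n → ℕ) (g-sym : ∀ x z → g x z ≡ g z x) (q : Fin n → ℕ) (bound : ℕ)
    (outside : ∀ x z → Y x ≡ false → Y z ≡ false → g x z ≡ 0)
    (unmatched : ∀ a b → Y a ≡ true → Y b ≡ true → σ M a ≡ a → σ M b ≡ b → g a b ≡ 0)
    (cross : ∀ x a → Y x ≡ false → Y a ≡ true → g x a + g x (σ M a) ≤ q x * κ M a)
    (column : ∀ b → 2 * sum (λ a → ⟦ moved M a ⟧ * g a b) ≤ bound) where

    private
      out : Fin n → ℕ
      out x = ⟦ not (Y x) ⟧

      m : Fin n → ℕ
      m a = ⟦ moved M a ⟧

      col : Fin n → ℕ
      col b = sum (λ a → m a * g a b)

      f₁ f₂ : Fin n → Fin n → ℕ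
      f₁ x z = out x * g x z
      f₂ x z = κ M z * (m x * g x z)

      unfixed : ∀ {a} → moved M a ≡ false → σ M a ≡ a
      unfixed {a} eq with σ M a ≟ a
      ... | yes fix = fix

      -- A pair of nonzero weight has exactly one end outside `Y`, or lies in `Y` and has a matched
      -- end.
      pointwise : ∀ x z → g x z ≤ (f₁ x z + f₁ z x) + (⟦ Y z ⟧ * (m x * g x z) + ⟦ Y x ∧ not (moved M x) ⟧ * (m z * g z x))
      pointwise x z rewrite g-sym z x with Y x in Yx | Y z in Yz | moved M x in mx | moved M z in mz
      ... | false | _     | _     | _     = ≤-trans (m≤m+n (g x z) 0) (≤-trans (m≤m+n (g x z + 0) _) (m≤m+n _ _))
      ... | true  | false | _     | _     = ≤-trans (m≤m+n (g x z) 0) (m≤m+n (g x z + 0) _)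
      ... | true  | true  | true  | _     = ≤-trans (≤-trans (m≤m+n (g x z) 0) (m≤m+n (g x z + 0) 0)) (m≤m+n (g x z + 0 + 0) _)
      ... | true  | true  | false | true  = ≤-trans (m≤m+n (g x z) 0) (m≤m+n (g x z + 0) 0)
      ... | true  | true  | false | false = ≤-reflexive (unmatched x z Yx Yz (unfixed mx) (unfixed mz))

      row-bound : ∀ x → 2 * sum (f₁ x) ≤ out x * q x * K M
      row-bound x with Y x in Yx
      ... | true  = ≤-reflexive (cong (2 *_) (sum-zero {n} {λ _ → 0} (λ _ → refl)))
      ... | false = begin
        2 * sum (λ z → 1 * g x z)             ≡⟨ cong (2 *_) (sum-cong-≗ (λ z → *-identityˡ (g x z))) ⟩
        -- One of the two copies is reindexed along `σ`, so that `cross` applies to each summand.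
        2 * sum (g x)                         ≡⟨ cong (sum (g x) +_) (trans (+-identityʳ _) (reindex M (g x))) ⟩
        sum (g x) + sum (g x ∘ σ M)           ≡⟨ ∑-distrib-+ (g x) (g x ∘ σ M) ⟨
        sum (λ z → g x z + g x (σ M z))       ≤⟨ sum-mono-≤ entry ⟩
        sum (λ z → q x * κ M z)               ≡⟨ sum-scale (q x) (κ M) ⟩
        q x * K M                             ≡⟨ cong (_* K M) (*-identityˡ (q x)) ⟨
        1 * q x * K M                         ∎
        where
        open ≤-Reasoning
        entry : ∀ z → g x z + g x (σ M z) ≤ q x * κ M z
        entry z with Y z in Yz
        ... | true = ≤-trans (cross x z Yx Yz) (≤-reflexive (cong (λ b → q x * (⟦ b ⟧ + ⟦ b ∧ not (moved M z) ⟧)) Yz))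
        ... | false with σ M z ≟ z
        ...   | yes fix = ≤-trans (≤-reflexive (cong₂ _+_ (outside x z Yx Yz) (trans (cong (g x) fix) (outside x z Yx Yz)))) z≤n
        ...   | no ¬fix = ⊥-elim (false≢true (trans (sym Yz) (matched-∈ M z ¬fix)))

    -- Pairs leaving `Y` are paid for by the rows of their outer ends. Pairs inside `Y` are paid for
    -- by columns summed over matched vertices: a matched z is met in one order, an unmatched z in
    -- both, which is the weight `κ z`.
    matching-bound : 2 * ∑∑ g ≤ K M * (2 * sum (λ x → out x * q x) + bound)
    matching-bound = begin
      2 * ∑∑ g
        ≤⟨ *-monoʳ-≤ 2 (∑∑-mono-≤ pointwise) ⟩
      2 * ∑∑ (λ x z → (f₁ x z + f₁ z x) + (h₁ z x + h₂ x z))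
        ≡⟨ cong (2 *_) (trans (∑∑-+ (λ x z → f₁ x z + f₁ z x) (λ x z → h₁ z x + h₂ x z)) (cong₂ _+_ (∑∑-+ f₁ (λ x z → f₁ z x)) (∑∑-+ (λ x z → h₁ z x) h₂))) ⟩
      2 * ((∑∑ f₁ + ∑∑ (λ x z → f₁ z x)) + (∑∑ (λ x z → h₁ z x) + ∑∑ h₂))
        ≡⟨ cong (2 *_) (cong₂ _+_ (cong (∑∑ f₁ +_) (∑-comm (λ x z → f₁ z x))) (cong (_+ ∑∑ h₂) (∑-comm (λ x z → h₁ z x)))) ⟩
      2 * ((∑∑ f₁ + ∑∑ f₁) + (∑∑ h₁ + ∑∑ h₂))
        ≡⟨ cong (λ w → 2 * ((∑∑ f₁ + ∑∑ f₁) + w)) columns ⟩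
      2 * ((∑∑ f₁ + ∑∑ f₁) + sum (λ z → κ M z * col z))
        ≡⟨ regroup (∑∑ f₁) (sum (λ z → κ M z * col z)) ⟩
      2 * (2 * ∑∑ f₁) + 2 * sum (λ z → κ M z * col z)
        ≤⟨ +-mono-≤ (*-monoʳ-≤ 2 rows-bound) columns-bound ⟩
      2 * (sum (λ x → out x * q x) * K M) + K M * bound
        ≡⟨ factor (sum (λ x → out x * q x)) (K M) bound ⟩
      K M * (2 * sum (λ x → out x * q x) + bound) ∎
      where
      open ≤-Reasoning
      h₁ h₂ : Fin n → Fin n → ℕ
      h₁ z x = ⟦ Y z ⟧ * (m x * g x z)
      h₂ x z = ⟦ Y x ∧ not (moved M x) ⟧ * (m z * g z x)

      regroup : ∀ a b → 2 * ((a + a) + b) ≡ 2 * (2 * a) + 2 * b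
      regroup = solve-∀
      factor : ∀ a b c → 2 * (a * b) + b * c ≡ b * (2 * a + c)
      factor = solve-∀

      columns : ∑∑ h₁ + ∑∑ h₂ ≡ sum (λ z → κ M z * col z)
      columns = trans (sym (∑-distrib-+ (λ z → sum (h₁ z)) (λ z → sum (h₂ z)))) (sum-cong-≗ λ z →
        trans (cong₂ _+_ (sum-scale ⟦ Y z ⟧ (λ x → m x * g x z)) (sum-scale ⟦ Y z ∧ not (moved M z) ⟧ (λ x → m x * g x z)))
          (sym (*-distribʳ-+ (col z) ⟦ Y z ⟧ ⟦ Y z ∧ not (moved M z) ⟧)))

      rows-bound : 2 * ∑∑ f₁ ≤ sum (λ x → out x * q x) * K M
      rows-bound = begin
        2 * ∑∑ f₁                            ≡⟨ sum-scale 2 (λ x → sum (f₁ x)) ⟨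
        sum (λ x → 2 * sum (f₁ x))           ≤⟨ sum-mono-≤ row-bound ⟩
        sum (λ x → out x * q x * K M)        ≡⟨ *-distribʳ-sum (K M) (λ x → out x * q x) ⟨
        sum (λ x → out x * q x) * K M        ∎

      columns-bound : 2 * sum (λ z → κ M z * col z) ≤ K M * bound
      columns-bound = begin
        2 * sum (λ z → κ M z * col z)        ≡⟨ sum-scale 2 (λ z → κ M z * col z) ⟨
        sum (λ z → 2 * (κ M z * col z))      ≤⟨ sum-mono-≤ (λ z → ≤-trans (≤-reflexive (swap (κ M z) (col z))) (*-monoʳ-≤ (κ M z) (column z))) ⟩
        sum (λ z → κ M z * bound)            ≡⟨ *-distribʳ-sum bound (κ M) ⟨
        K M * bound                          ∎
        where
        swap : ∀ a b → 2 * (a * b) ≡ a * (2 * b)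
        swap = solve-∀

-- Five-wheels

next prev : Fin 5 → Fin 5
next 0F = 1F
next 1F = 2F
next 2F = 3F
next 3F = 4F
next 4F = 0F
prev 0F = 4F
prev 1F = 0F
prev 2F = 1F
prev 3F = 2F
prev 4F = 3F

prev-next : ∀ i → prev (next i) ≡ i
prev-next 0F = refl
prev-next 1F = refl
prev-next 2F = refl
prev-next 3F = refl
prev-next 4F = refl

next≢ : ∀ i → next i ≢ i
next≢ 0F ()
next≢ 1F ()
next≢ 2F ()
next≢ 3F ()
next≢ 4F ()

independent₅ : BoolFun 5
independent₅ a b c d e = not (a ∧ b) ∧ not (b ∧ c) ∧ not (c ∧ d) ∧ not (d ∧ e) ∧ not (e ∧ a)

-- An independent set of the 5-cycle has at most two elements, and two elements are i - 1 and i + 1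
-- for a unique i. For such sets `isolated` means at most one element.
between : (Fin 5 → Bool) → Fin 5 → Bool
between b i = b (prev i) ∧ b (next i)

bits : Bool → Bool → Bool → Bool → Bool → Fin 5 → Bool
bits a b c d e 0F = a
bits a b c d e 1F = b
bits a b c d e 2F = c
bits a b c d e 3F = d
bits a b c d e 4F = e

isolated : (Fin 5 → Bool) → Bool
isolated b = not (between b 0F ∨ between b 1F ∨ between b 2F ∨ between b 3F ∨ between b 4F)

module Independent (b : Fin 5 → Bool) (ind : ∀ i → b i ≡ true → b (next i) ≡ true → ⊥) where

  private
    holds : independent₅ (b 0F) (b 1F) (b 2F) (b 3F) (b 4F) ≡ true
    holds = ∧-intro (pair 0F) (∧-intro (pair 1F) (∧-intro (pair 2F) (∧-intro (pair 3F) (pair 4F))))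
      where
      pair : ∀ i → not (b i ∧ b (next i)) ≡ true
      pair i with b i in eq | b (next i) in eq′
      ... | true  | true  = ⊥-elim (ind i eq eq′)
      ... | true  | false = refl
      ... | false | _     = refl

    by : (f : (Fin 5 → Bool) → Bool) →
      T (tautology 5 λ a b c d e → not (independent₅ a b c d e) ∨ f (bits a b c d e)) →
      T (f (bits (b 0F) (b 1F) (b 2F) (b 3F) (b 4F)))
    by f taut = implies (check 5 (λ a b c d e → not (independent₅ a b c d e) ∨ f (bits a b c d e)) taut
      (b 0F) (b 1F) (b 2F) (b 3F) (b 4F)) holds

  at-most-two : count b ≤ 2
  at-most-two = ≤ᵇ⇒≤ _ _ (by (λ b → count b ≤ᵇ 2) _)

  unique-gap : count (between b) + ⟦ isolated b ⟧ ≡ 1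
  unique-gap = ≡ᵇ⇒≡ _ _ (by (λ b → count (between b) + ⟦ isolated b ⟧ ≡ᵇ 1) _)

  count+isolated : count b + ⟦ isolated b ⟧ ≤ 2
  count+isolated = ≤ᵇ⇒≤ _ _ (by (λ b → count b + ⟦ isolated b ⟧ ≤ᵇ 2) _)

  -- i + 2 and i - 2 are consecutive, and each of them is next to one of i + 1 and i - 1.
  opposite : ∀ i → ⟦ between b i ⟧ + (⟦ b (next (next i)) ⟧ + ⟦ b (prev (prev i)) ⟧) ≤ 1
  opposite 0F = ≤ᵇ⇒≤ _ _ (by (λ b → ⟦ between b 0F ⟧ + (⟦ b 2F ⟧ + ⟦ b 3F ⟧) ≤ᵇ 1) _)
  opposite 1F = ≤ᵇ⇒≤ _ _ (by (λ b → ⟦ between b 1F ⟧ + (⟦ b 3F ⟧ + ⟦ b 4F ⟧) ≤ᵇ 1) _)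
  opposite 2F = ≤ᵇ⇒≤ _ _ (by (λ b → ⟦ between b 2F ⟧ + (⟦ b 4F ⟧ + ⟦ b 0F ⟧) ≤ᵇ 1) _)
  opposite 3F = ≤ᵇ⇒≤ _ _ (by (λ b → ⟦ between b 3F ⟧ + (⟦ b 0F ⟧ + ⟦ b 1F ⟧) ≤ᵇ 1) _)
  opposite 4F = ≤ᵇ⇒≤ _ _ (by (λ b → ⟦ between b 4F ⟧ + (⟦ b 1F ⟧ + ⟦ b 2F ⟧) ≤ᵇ 1) _)

-- Expands (B - a)(p - h) ≥ 0.
rearrangement : ∀ {a B h p} → a ≤ B → h ≤ p → a * p + h * B ≤ h * a + p * B
rearrangement {a} {B} {h} {p} a≤B h≤p with k , refl ← m≤n⇒∃[o]m+o≡n a≤B | l , refl ← m≤n⇒∃[o]m+o≡n h≤p =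
  ≤-trans (m≤m+n _ (k * l)) (≤-reflexive (identity a k h l))
  where
  identity : ∀ a k h l → a * (h + l) + h * (a + k) + k * l ≡ h * a + (h + l) * (a + k)
  identity = solve-∀

-- `a i` counts the vertices of X joined to the rim vertices i - 1 and i + 1, `a′` the isolated
-- ones; `p i` is the degree of rim vertex i in X, and `o` is 2 e(X). Summing (B - a i)(p i - h) ≥ 0
-- yields o ≤ hξ + BE, and 2B = E + h turns this into squares.
rim-arithmetic : ∀ (a p : Fin 5 → ℕ) {a′ ξ h B E o} → ξ ≡ B + 2 * h → E + 5 * h ≡ 2 * ξ →
  (∀ i → a i ≤ B) → (∀ i → h ≤ p i) → sum a + a′ ≡ ξ → sum p + a′ ≤ 2 * ξ →
  o ≤ sum (λ i → a i * p i) + a′ * (B + h) → 5 * o ≤ 2 * (ξ * ξ + E * E)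
rim-arithmetic a p {a′} {ξ} {h} {B} {E} {o} ξ≡ E≡ a≤B h≤p ∑a ∑p o≤ = *-cancelˡ-≤ 2 (begin
  2 * (5 * o)                         ≡⟨ double o ⟩
  10 * o                              ≤⟨ *-monoʳ-≤ 10 o-bound ⟩
  10 * (h * ξ + B * E)                ≡⟨ expand h ξ B E ⟩
  5 * h * (2 * ξ) + 5 * (2 * B) * E   ≡⟨ cong₂ (λ s t → 5 * h * s + 5 * t * E) (sym E≡) 2B≡ ⟩
  5 * h * (E + 5 * h) + 5 * (E + h) * E ≡⟨ square h E ⟩
  (E + 5 * h) * (E + 5 * h) + 4 * (E * E) ≡⟨ cong (λ s → s * s + 4 * (E * E)) E≡ ⟩
  2 * ξ * (2 * ξ) + 4 * (E * E)       ≡⟨ collect ξ E ⟩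
  2 * (2 * (ξ * ξ + E * E))           ∎)
  where
  open ≤-Reasoning
  double : ∀ o → 2 * (5 * o) ≡ 10 * o
  double = solve-∀
  expand : ∀ h ξ B E → 10 * (h * ξ + B * E) ≡ 5 * h * (2 * ξ) + 5 * (2 * B) * E
  expand = solve-∀
  square : ∀ h E → 5 * h * (E + 5 * h) + 5 * (E + h) * E ≡ (E + 5 * h) * (E + 5 * h) + 4 * (E * E)
  square = solve-∀
  collect : ∀ ξ E → 2 * ξ * (2 * ξ) + 4 * (E * E) ≡ 2 * (2 * (ξ * ξ + E * E))
  collect = solve-∀

  2B≡ : 2 * B ≡ E + h
  2B≡ = +-cancelʳ-≡ (4 * h) _ _ (trans (trans (eq₁ B h) (trans (cong (2 *_) (sym ξ≡)) (sym E≡))) (eq₂ E h))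
    where
    eq₁ : ∀ B h → 2 * B + 4 * h ≡ 2 * (B + 2 * h)
    eq₁ = solve-∀
    eq₂ : ∀ E h → E + 5 * h ≡ E + h + 4 * h
    eq₂ = solve-∀

  o-bound : o ≤ h * ξ + B * E
  o-bound = +-cancelʳ-≤ (5 * (h * B)) _ _ (begin
    o + 5 * (h * B)
      ≤⟨ +-monoˡ-≤ _ o≤ ⟩
    sum (λ i → a i * p i) + a′ * (B + h) + 5 * (h * B)
      ≡⟨ reorder (sum (λ i → a i * p i)) (a′ * (B + h)) (5 * (h * B)) ⟩
    sum (λ i → a i * p i) + 5 * (h * B) + a′ * (B + h)
      ≡⟨ cong (_+ a′ * (B + h)) (trans (cong (sum (λ i → a i * p i) +_) (sym (sum-const 5 (h * B)))) (sym (∑-distrib-+ (λ i → a i * p i) (λ _ → h * B)))) ⟩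
    sum (λ i → a i * p i + h * B) + a′ * (B + h)
      ≤⟨ +-monoˡ-≤ _ (sum-mono-≤ (λ i → rearrangement (a≤B i) (h≤p i))) ⟩
    sum (λ i → h * a i + p i * B) + a′ * (B + h)
      ≡⟨ cong (_+ a′ * (B + h)) (trans (∑-distrib-+ (λ i → h * a i) (λ i → p i * B)) (cong₂ _+_ (sum-scale h a) (sym (*-distribʳ-sum B p)))) ⟩
    h * sum a + sum p * B + a′ * (B + h)
      ≡⟨ gather h (sum a) (sum p) B a′ ⟩
    h * (sum a + a′) + B * (sum p + a′)
      ≤⟨ +-mono-≤ (≤-reflexive (cong (h *_) ∑a)) (*-monoʳ-≤ B ∑p) ⟩
    h * ξ + B * (2 * ξ)
      ≡⟨ cong (λ s → h * ξ + B * s) E≡ ⟨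
    h * ξ + B * (E + 5 * h)
      ≡⟨ final h ξ B E ⟩
    h * ξ + B * E + 5 * (h * B) ∎)
    where
    reorder : ∀ x y z → x + y + z ≡ x + z + y
    reorder = solve-∀
    gather : ∀ h s t B a′ → h * s + t * B + a′ * (B + h) ≡ h * (s + a′) + B * (t + a′)
    gather = solve-∀
    final : ∀ h ξ B E → h * ξ + B * (E + 5 * h) ≡ h * ξ + B * E + 5 * (h * B)
    final = solve-∀

module Wheel (G : K₄FreeGraph n) (v : Fin n) where
  open K₄FreeGraph G

  X Y : Fin n → Bool
  X = adj v
  Y = not ∘ X

  ξ : ℕ
  ξ = count X

  p : Fin n → ℕ
  p = deg adj X

  -- A closed walk of length five in N(v). It is a genuine cycle: a coincidence at distance two
  -- would leave a triangle in N(v), hence a K₄.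
  record Rim : Set where
    field
      c   : Fin 5 → Fin n
      hub : ∀ i → v ∼ c i
      rim : ∀ i → c i ∼ c (next i)

    weight : ℕ
    weight = sum (p ∘ c)

    -- Optimality under exchange of one rim vertex, which compares x with the rim vertex whose place
    -- it could take.
    Optimal : Set
    Optimal = ∀ i x → v ∼ x → c (prev i) ∼ x → c (next i) ∼ x → p x ≤ p (c i)

  open Rim

  module _ (R : Rim) (i : Fin 5) {x : Fin n} (v∼x : v ∼ x) (left : c R (prev i) ∼ x) (right : c R (next i) ∼ x) where

    replace : Rim
    replace .c j with j ≟ i
    ... | yes _ = x
    ... | no _  = c R j
    replace .hub j with j ≟ i
    ... | yes _ = v∼x
    ... | no _  = hub R j
    replace .rim j with j ≟ i | next j ≟ i
    ... | yes refl | yes eq   = ⊥-elim (next≢ j eq)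
    ... | yes refl | no _     = ∼-sym right
    ... | no _     | yes refl = subst (λ k → c R k ∼ x) (prev-next j) left
    ... | no _     | no _     = rim R j

    replace-weight : p (c R i) < p x → weight R < weight replace
    replace-weight gain = sum-mono-< pointwise i strict
      where
      pointwise : ∀ j → p (c R j) ≤ p (c replace j)
      pointwise j with j ≟ i
      ... | yes refl = <⇒≤ gain
      ... | no _     = ≤-refl
      strict : p (c R i) < p (c replace i)
      strict with i ≟ i
      ... | yes _  = gain
      ... | no i≢i = ⊥-elim (i≢i refl)

  optimal-rim : Rim → Σ[ R ∈ Rim ] Optimal R
  optimal-rim = ascend weight (5 * n) weight≤ improve
    where
    weight≤ : ∀ R → weight R ≤ 5 * n
    weight≤ R = ≤-trans (sum-mono-≤ {5} (λ i → count≤n (neighbours adj X (c R i)))) (≤-reflexive (sum-const 5 n))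

    improve : ∀ R → (∃[ R′ ] weight R < weight R′) ⊎ Optimal R
    improve R with any? (λ i → any? (λ x → (adj v x ≟ᵇ true) ×-dec (adj (c R (prev i)) x ≟ᵇ true) ×-dec (adj (c R (next i)) x ≟ᵇ true) ×-dec (p (c R i) <? p x)))
    ... | yes (i , x , v∼x , l , r , gain) = inj₁ (replace R i v∼x l r , replace-weight R i v∼x l r gain)
    ... | no none = inj₂ λ i x v∼x l r → ≮⇒≥ λ gain → none (i , x , v∼x , l , r , gain)

  -- N(v) is triangle-free, so adjacent vertices have disjoint neighbourhoods in it.
  p+p≤ξ : ∀ {x u} → v ∼ x → v ∼ u → x ∼ u → p x + p u ≤ ξ
  p+p≤ξ {x} {u} v∼x v∼u x∼u = ≤-trans (≤-reflexive (sym (∑-distrib-+ (⟦_⟧ ∘ neighbours adj X x) (⟦_⟧ ∘ neighbours adj X u)))) (sum-mono-≤ pointwise)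
    where
    pointwise : ∀ y → ⟦ X y ∧ adj x y ⟧ + ⟦ X y ∧ adj u y ⟧ ≤ ⟦ X y ⟧
    pointwise y with adj v y in vy | adj x y in xy | adj u y in uy
    ... | true  | true  | true  = ⊥-elim (no-K₄ v∼x v∼u vy x∼u xy uy)
    ... | true  | true  | false = ≤-refl
    ... | true  | false | true  = ≤-refl
    ... | true  | false | false = z≤n
    ... | false | _     | _     = z≤n

  module _ (R : Rim) (h : ℕ) (min : ∀ u → v ∼ u → h ≤ p u) where

    private
      b : Fin n → Fin 5 → Bool
      b x i = adj (c R i) x

      ind : ∀ {x} → v ∼ x → ∀ i → b x i ≡ true → b x (next i) ≡ true → ⊥
      ind v∼x i l r = no-K₄ (hub R i) (hub R (next i)) v∼x (rim R i) l r

      A : Fin 5 → ℕ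
      A i = count λ x → X x ∧ between (b x) i

      A′ : ℕ
      A′ = count λ x → X x ∧ isolated (b x)

    -- A vertex of X sees an independent set of the rim: at most two vertices, and at most one if it
    -- is isolated.
    rim-degrees : sum (p ∘ c R) + A′ ≤ 2 * ξ
    rim-degrees = begin
      sum (p ∘ c R) + A′ ≡⟨ cong (_+ A′) (∑-comm (λ i x → ⟦ X x ∧ b x i ⟧)) ⟩
      sum (λ x → sum (λ i → ⟦ X x ∧ b x i ⟧)) + A′ ≡⟨ ∑-distrib-+ (λ x → sum (λ i → ⟦ X x ∧ b x i ⟧)) (λ x → ⟦ X x ∧ isolated (b x) ⟧) ⟨
      sum (λ x → sum (λ i → ⟦ X x ∧ b x i ⟧) + ⟦ X x ∧ isolated (b x) ⟧) ≤⟨ sum-mono-≤ pointwise ⟩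
      sum (λ x → 2 * ⟦ X x ⟧) ≡⟨ sum-scale 2 (⟦_⟧ ∘ X) ⟩
      2 * ξ ∎
      where
      open ≤-Reasoning
      pointwise : ∀ x → sum (λ i → ⟦ X x ∧ b x i ⟧) + ⟦ X x ∧ isolated (b x) ⟧ ≤ 2 * ⟦ X x ⟧
      pointwise x with adj v x in vx
      ... | true  = Independent.count+isolated (b x) (ind vx)
      ... | false = z≤n

    5h≤2ξ : 5 * h ≤ 2 * ξ
    5h≤2ξ = ≤-trans (≤-trans (≤-reflexive (sym (sum-const 5 h))) (sum-mono-≤ {5} (λ i → min (c R i) (hub R i)))) (≤-trans (m≤m+n _ A′) rim-degrees)

    -- Sum the degrees in X by gaps: a vertex x between c (i - 1) and c (i + 1) could replace c i,
    -- so p x ≤ p (c i), while an isolated x has p x ≤ ξ - h.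
    hub-link : Optimal R → ∀ {E} → E + 5 * h ≡ 2 * ξ → 5 * triangles v ≤ 2 * (ξ * ξ + E * E)
    hub-link optimal {E} E≡ = rim-arithmetic A (p ∘ c R) {B = ξ ∸ 2 * h} {E = E} (sym (m∸n+n≡m 2h≤ξ)) E≡
      (λ i → m+n≤o⇒m≤o∸n (A i) (A+2h≤ξ i)) (λ i → min (c R i) (hub R i)) partition rim-degrees total
      where
      open ≤-Reasoning

      -- The vertices in gap i and the neighbourhoods of c (i + 2) and c (i - 2) are disjoint
      -- subsets of X.
      A+2h≤ξ : ∀ i → A i + 2 * h ≤ ξ
      A+2h≤ξ i = begin
        A i + 2 * h                                      
          ≤⟨ +-monoʳ-≤ (A i) (+-mono-≤ (min _ (hub R (next (next i)))) (≤-trans (≤-reflexive (+-identityʳ h)) (min _ (hub R (prev (prev i)))))) ⟩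
        A i + (p (c R (next (next i))) + p (c R (prev (prev i))))
          ≡⟨ cong (A i +_) (∑-distrib-+ (λ x → ⟦ X x ∧ b x (next (next i)) ⟧) (λ x → ⟦ X x ∧ b x (prev (prev i)) ⟧)) ⟨
        A i + sum (λ x → ⟦ X x ∧ b x (next (next i)) ⟧ + ⟦ X x ∧ b x (prev (prev i)) ⟧)
          ≡⟨ ∑-distrib-+ (λ x → ⟦ X x ∧ between (b x) i ⟧) (λ x → ⟦ X x ∧ b x (next (next i)) ⟧ + ⟦ X x ∧ b x (prev (prev i)) ⟧) ⟨
        sum (λ x → ⟦ X x ∧ between (b x) i ⟧ + (⟦ X x ∧ b x (next (next i)) ⟧ + ⟦ X x ∧ b x (prev (prev i)) ⟧)) ≤⟨ sum-mono-≤ pointwise ⟩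
        ξ ∎
        where
        pointwise : ∀ x → ⟦ X x ∧ between (b x) i ⟧ + (⟦ X x ∧ b x (next (next i)) ⟧ + ⟦ X x ∧ b x (prev (prev i)) ⟧) ≤ ⟦ X x ⟧
        pointwise x with adj v x in vx
        ... | true  = Independent.opposite (b x) (ind vx) i
        ... | false = z≤n

      2h≤ξ : 2 * h ≤ ξ
      2h≤ξ = ≤-trans (m≤n+m (2 * h) (A 0F)) (A+2h≤ξ 0F)

      gaps : ∀ x → sum (λ i → ⟦ X x ∧ between (b x) i ⟧) + ⟦ X x ∧ isolated (b x) ⟧ ≡ ⟦ X x ⟧
      gaps x with adj v x in vx
      ... | true  = Independent.unique-gap (b x) (ind vx)
      ... | false = refl

      partition : sum A + A′ ≡ ξ
      partition = trans (cong (_+ A′) (∑-comm (λ i x → ⟦ X x ∧ between (b x) i ⟧)))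
        (trans (sym (∑-distrib-+ (λ x → sum (λ i → ⟦ X x ∧ between (b x) i ⟧)) (λ x → ⟦ X x ∧ isolated (b x) ⟧))) (sum-cong-≗ gaps))

      -- A neighbour of x in X has degree at least h, so `p+p≤ξ` applies; if there is none, then h =
      -- 0.
      p+h≤ξ : ∀ x → v ∼ x → p x + h ≤ ξ
      p+h≤ξ x v∼x with p x in px
      ... | zero  = ≤-trans (min x v∼x) (≤-trans (≤-reflexive px) z≤n)
      ... | suc _ with y , 0<y ← sum-positive (⟦_⟧ ∘ neighbours adj X x) (subst (0 <_) (sym px) z<s)
                  with v∼y , x∼y ← ∧-true {X y} (⟦⟧-positive 0<y) =
        ≤-trans (≤-reflexive (cong (_+ h) (sym px))) (≤-trans (+-monoʳ-≤ (p x) (min y v∼y)) (p+p≤ξ v∼x v∼y x∼y))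

      B+h : ξ ∸ 2 * h + h ≡ ξ ∸ h
      B+h = trans (cong (λ w → ξ ∸ w + h) (cong (h +_) (+-identityʳ h)))
        (trans (cong (_+ h) (sym (∸-+-assoc ξ h h))) (m∸n+n≡m (m+n≤o⇒m≤o∸n h (≤-trans (≤-reflexive (cong (h +_) (sym (+-identityʳ h)))) 2h≤ξ))))

      total : triangles v ≤ sum (λ i → A i * p (c R i)) + A′ * (ξ ∸ 2 * h + h)
      total = begin
        triangles v
          ≡⟨ pairs-deg adj X ⟩
        sum (λ x → ⟦ X x ⟧ * p x)
          ≡⟨ sum-cong-≗ (λ x → cong (_* p x) (gaps x)) ⟨
        sum (λ x → (sum (λ i → ⟦ X x ∧ between (b x) i ⟧) + ⟦ X x ∧ isolated (b x) ⟧) * p x)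
          ≤⟨ sum-mono-≤ pointwise ⟩
        sum (λ x → sum (λ i → ⟦ X x ∧ between (b x) i ⟧ * p (c R i)) + ⟦ X x ∧ isolated (b x) ⟧ * (ξ ∸ 2 * h + h))
          ≡⟨ ∑-distrib-+ (λ x → sum (λ i → ⟦ X x ∧ between (b x) i ⟧ * p (c R i))) (λ x → ⟦ X x ∧ isolated (b x) ⟧ * (ξ ∸ 2 * h + h)) ⟩
        sum (λ x → sum (λ i → ⟦ X x ∧ between (b x) i ⟧ * p (c R i))) + sum (λ x → ⟦ X x ∧ isolated (b x) ⟧ * (ξ ∸ 2 * h + h))
          ≡⟨ cong₂ _+_ (trans (∑-comm (λ x i → ⟦ X x ∧ between (b x) i ⟧ * p (c R i))) (sum-cong-≗ {5} (λ i → sym (*-distribʳ-sum (p (c R i)) (λ x → ⟦ X x ∧ between (b x) i ⟧)))))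
               (sym (*-distribʳ-sum (ξ ∸ 2 * h + h) (λ x → ⟦ X x ∧ isolated (b x) ⟧))) ⟩
        sum (λ i → A i * p (c R i)) + A′ * (ξ ∸ 2 * h + h) ∎
        where
        pointwise : ∀ x → (sum (λ i → ⟦ X x ∧ between (b x) i ⟧) + ⟦ X x ∧ isolated (b x) ⟧) * p x
          ≤ sum (λ i → ⟦ X x ∧ between (b x) i ⟧ * p (c R i)) + ⟦ X x ∧ isolated (b x) ⟧ * (ξ ∸ 2 * h + h)
        pointwise x = begin
          (sum (λ i → ⟦ X x ∧ between (b x) i ⟧) + ⟦ X x ∧ isolated (b x) ⟧) * p x
            ≡⟨ *-distribʳ-+ (p x) (sum (λ i → ⟦ X x ∧ between (b x) i ⟧)) ⟦ X x ∧ isolated (b x) ⟧ ⟩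
          sum (λ i → ⟦ X x ∧ between (b x) i ⟧) * p x + ⟦ X x ∧ isolated (b x) ⟧ * p x
            ≡⟨ cong (_+ ⟦ X x ∧ isolated (b x) ⟧ * p x) (*-distribʳ-sum (p x) (λ i → ⟦ X x ∧ between (b x) i ⟧)) ⟩
          sum (λ i → ⟦ X x ∧ between (b x) i ⟧ * p x) + ⟦ X x ∧ isolated (b x) ⟧ * p x
            ≤⟨ +-mono-≤ (sum-mono-≤ {5} at-gap) off-gap ⟩
          sum (λ i → ⟦ X x ∧ between (b x) i ⟧ * p (c R i)) + ⟦ X x ∧ isolated (b x) ⟧ * (ξ ∸ 2 * h + h) ∎
          where
          at-gap : ∀ i → ⟦ X x ∧ between (b x) i ⟧ * p x ≤ ⟦ X x ∧ between (b x) i ⟧ * p (c R i)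
          at-gap i with adj v x in vx | b x (prev i) in l | b x (next i) in r
          ... | true  | true  | true  = *-monoʳ-≤ 1 (optimal i x vx l r)
          ... | true  | true  | false = z≤n
          ... | true  | false | _     = z≤n
          ... | false | _     | _     = z≤n
          off-gap : ⟦ X x ∧ isolated (b x) ⟧ * p x ≤ ⟦ X x ∧ isolated (b x) ⟧ * (ξ ∸ 2 * h + h)
          off-gap with adj v x in vx
          ... | true  = *-monoʳ-≤ ⟦ isolated (b x) ⟧ (≤-trans (m+n≤o⇒m≤o∸n (p x) (p+h≤ξ x vx)) (≤-reflexive (sym B+h)))
          ... | false = z≤n

  module _ (R : Rim) (M : Matchings.Matching G Y) (maximal : Matchings.Matching.Maximal M) where
    open Matchings G Y using (module Matching; matching-bound)
    open Matching M

    private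
      g : Fin n → Fin n → Fin n → ℕ
      g u x z = ⟦ adj u x ∧ adj u z ∧ adj x z ⟧

      g-sym : ∀ u x z → g u x z ≡ g u z x
      g-sym u x z rewrite adj-sym z x with adj u x | adj u z
      ... | true  | true  = refl
      ... | true  | false = refl
      ... | false | true  = refl
      ... | false | false = refl

      Y-false : ∀ {x} → Y x ≡ false → v ∼ x
      Y-false {x} eq = trans (sym (not-involutive (X x))) (cong not eq)

      outside : ∀ {u} → v ∼ u → ∀ x z → Y x ≡ false → Y z ≡ false → g u x z ≡ 0
      outside {u} v∼u x z Yx Yz with adj u x in ux | adj u z in uz | adj x z in xz
      ... | true  | true  | true  = ⊥-elim (no-K₄ v∼u (Y-false Yx) (Y-false Yz) ux uz xz)
      ... | true  | true  | false = refl
      ... | true  | false | _     = refl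
      ... | false | _     | _     = refl

      unmatched : ∀ u a b → Y a ≡ true → Y b ≡ true → σ a ≡ a → σ b ≡ b → g u a b ≡ 0
      unmatched u a b Ya Yb fixa fixb rewrite ¬-not (maximal a b Ya Yb fixa fixb) =
        cong ⟦_⟧ (trans (cong (adj u a ∧_) (∧-zeroʳ (adj u b))) (∧-zeroʳ (adj u a)))

      -- If both terms were 1, then u, x and the matching edge at a would span a K₄.
      matched : ∀ u x {a} → σ a ≢ a → g u x a + g u x (σ a) ≤ ⟦ adj u x ⟧
      matched u x {a} ¬fix with adj u x in ux | adj u a in ua | adj u (σ a) in us | adj x a in xa | adj x (σ a) in xs
      ... | true  | true  | true  | true  | true  = ⊥-elim (no-K₄ ux ua us xa xs (matched-edge a ¬fix))
      ... | true  | true  | true  | true  | false = ≤-refl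
      ... | true  | true  | true  | false | true  = ≤-refl
      ... | true  | true  | true  | false | false = z≤n
      ... | true  | true  | false | true  | _     = ≤-refl
      ... | true  | true  | false | false | _     = z≤n
      ... | true  | false | true  | _     | true  = ≤-refl
      ... | true  | false | true  | _     | false = z≤n
      ... | true  | false | false | _     | _     = z≤n
      ... | false | _     | _     | _     | _     = z≤n

      cross : ∀ u x a → Y a ≡ true → g u x a + g u x (σ a) ≤ ⟦ adj u x ⟧ * κ a
      cross u x a Ya with σ a ≟ a
      ... | no ¬fix rewrite Ya = ≤-trans (matched u x ¬fix) (≤-reflexive (sym (*-identityʳ _)))
      -- For an unmatched a the two summands coincide, and κ a = 2 allows for both.
      ... | yes fix rewrite Ya | fix with adj u x | adj u a | adj x a
      ...   | true  | true  | true  = ≤-refl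
      ...   | true  | true  | false = z≤n
      ...   | true  | false | _     = z≤n
      ...   | false | _     | _     = z≤n

      column : ∀ u b → 2 * sum (λ a → ⟦ moved a ⟧ * g u a b) ≤ size
      column u b = begin
        2 * sum f                              ≡⟨ cong (sum f +_) (trans (+-identityʳ (sum f)) (reindex f)) ⟩
        sum f + sum (f ∘ σ)                    ≡⟨ ∑-distrib-+ f (f ∘ σ) ⟨
        sum (λ a → f a + f (σ a))              ≤⟨ sum-mono-≤ pointwise ⟩
        size                                   ∎
        where
        open ≤-Reasoning
        f : Fin n → ℕ
        f a = ⟦ moved a ⟧ * g u a b
        pointwise : ∀ a → f a + f (σ a) ≤ ⟦ moved a ⟧
        pointwise a rewrite moved-σ a with σ a ≟ a
        ... | yes _ = z≤n
        ... | no ¬fix rewrite +-identityʳ (g u a b) | +-identityʳ (g u (σ a) b) | g-sym u a b | g-sym u (σ a) b =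
          ≤-trans (matched u b ¬fix) (≤ᵇ⇒≤ _ _ (check 1 (λ c → ⟦ c ⟧ ≤ᵇ 1) _ (adj u b)))

    -- With μ = size / 2 and η = K / 2 this says that the link of `u` has at most (p u + μ) η edges.
    link-in-X : ∀ u → v ∼ u → 2 * triangles u ≤ K * (2 * p u + size)
    link-in-X u v∼u = subst (λ s → 2 * triangles u ≤ K * (2 * s + size)) (sum-cong-≗ row)
      (matching-bound M (g u) (g-sym u) (λ x → ⟦ adj u x ⟧) size (outside v∼u) (unmatched u) (λ x a _ → cross u x a) (column u))
      where
      row : ∀ x → ⟦ not (Y x) ⟧ * ⟦ adj u x ⟧ ≡ ⟦ X x ∧ adj u x ⟧
      row x rewrite not-involutive (X x) with X x | adj u x
      ... | true  | true  = refl
      ... | true  | false = refl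
      ... | false | _     = refl

    rim-links : 2 * sum (triangles ∘ c R) ≤ K * (4 * ξ + 4 * size)
    rim-links = begin
      2 * sum (triangles ∘ c R)
        ≡⟨ cong (2 *_) (trans (∑-comm (λ i x → sum (g (c R i) x))) (sum-cong-≗ (λ x → ∑-comm (λ i z → g (c R i) x z)))) ⟩
      2 * ∑∑ w
        ≤⟨ matching-bound M w (λ x z → sum-cong-≗ {5} (λ i → g-sym (c R i) x z)) q (4 * size)
             (λ x z Yx Yz → sum-zero {5} (λ i → outside (hub R i) x z Yx Yz))
             (λ a b Ya Yb fa fb → sum-zero {5} (λ i → unmatched (c R i) a b Ya Yb fa fb)) w-cross w-column ⟩
      K * (2 * sum (λ x → ⟦ not (Y x) ⟧ * q x) + 4 * size)
        ≤⟨ *-monoʳ-≤ K (+-monoˡ-≤ (4 * size) (≤-trans (*-monoʳ-≤ 2 (sum-mono-≤ q-bound)) (≤-reflexive (trans (cong (2 *_) (sum-scale 2 (⟦_⟧ ∘ X))) (double ξ))))) ⟩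
      K * (4 * ξ + 4 * size) ∎
      where
      open ≤-Reasoning
      double : ∀ x → 2 * (2 * x) ≡ 4 * x
      double = solve-∀

      w : Fin n → Fin n → ℕ
      w x z = sum λ i → g (c R i) x z

      q : Fin n → ℕ
      q x = count λ i → adj (c R i) x

      q-bound : ∀ x → ⟦ not (Y x) ⟧ * q x ≤ 2 * ⟦ X x ⟧
      q-bound x rewrite not-involutive (X x) with adj v x in vx
      ... | false = z≤n
      ... | true  = ≤-trans (≤-reflexive (*-identityˡ (q x))) (Independent.at-most-two (λ i → adj (c R i) x)
        λ i l r → no-K₄ (hub R i) (hub R (next i)) vx (rim R i) l r)

      w-cross : ∀ x a → Y x ≡ false → Y a ≡ true → w x a + w x (σ a) ≤ q x * κ a
      w-cross x a _ Ya = begin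
        w x a + w x (σ a)                                   ≡⟨ ∑-distrib-+ {5} (λ i → g (c R i) x a) (λ i → g (c R i) x (σ a)) ⟨
        sum (λ i → g (c R i) x a + g (c R i) x (σ a))        ≤⟨ sum-mono-≤ {5} (λ i → cross (c R i) x a Ya) ⟩
        sum (λ i → ⟦ adj (c R i) x ⟧ * κ a)                 ≡⟨ *-distribʳ-sum {5} (κ a) (λ i → ⟦ adj (c R i) x ⟧) ⟨
        q x * κ a                                           ∎

      -- Links of consecutive rim vertices share no edge, or a K₄ would arise; so the rim vertices
      -- whose links contain ab are independent on the cycle.
      w≤2 : ∀ a b → w a b ≤ 2
      w≤2 a b = Independent.at-most-two (λ i → adj (c R i) a ∧ adj (c R i) b ∧ adj a b) λ i l r →
        let la , l′ = ∧-true {adj (c R i) a} l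
            lb , ab = ∧-true {adj (c R i) b} l′
            ra , r′ = ∧-true {adj (c R (next i)) a} r
            rb , _  = ∧-true {adj (c R (next i)) b} r′
        in no-K₄ (rim R i) la lb ra rb ab

      -- Bounding each weight by 2 beats `column` summed over the rim, which would give `5 * size`.
      w-column : ∀ b → 2 * sum (λ a → ⟦ moved a ⟧ * w a b) ≤ 4 * size
      w-column b = begin
        2 * sum (λ a → ⟦ moved a ⟧ * w a b) ≤⟨ *-monoʳ-≤ 2 (sum-mono-≤ (λ a → *-monoʳ-≤ ⟦ moved a ⟧ (w≤2 a b))) ⟩
        2 * sum (λ a → ⟦ moved a ⟧ * 2)     ≡⟨ cong (2 *_) (*-distribʳ-sum 2 (⟦_⟧ ∘ moved)) ⟨
        2 * (size * 2)                      ≡⟨ quadruple size ⟩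
        4 * size                            ∎
        where
        quadruple : ∀ s → 2 * (s * 2) ≡ 4 * s
        quadruple = solve-∀

-- Dense K₄-free graphs: no 5-wheel and no spindle

Dense : K₄FreeGraph n → Set
Dense {n} G = ∀ v → 8 * (n * n) < 45 * K₄FreeGraph.triangles G v

double-< : ∀ N t s → 8 * N < 45 * t → 2 * t ≤ s → 16 * N < 45 * s
double-< N t s dense t≤ = begin-strict
  16 * N         ≡⟨ *-assoc 2 8 N ⟩
  2 * (8 * N)    <⟨ *-monoʳ-< 2 dense ⟩
  2 * (45 * t)   ≡⟨ eq t ⟩
  45 * (2 * t)   ≤⟨ *-monoʳ-≤ 45 t≤ ⟩
  45 * s         ∎
  where
  open ≤-Reasoning
  eq : ∀ t → 2 * (45 * t) ≡ 45 * (2 * t)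
  eq = solve-∀

-- `tᵥ`, `tᵤ` and `tᵣ` are twice the link sizes of the hub, of a vertex of minimum degree in X, and
-- of the rim in total.
link-sizes-incompatible : ∀ n ξ h K m E tᵥ tᵤ tᵣ → E + 5 * h ≡ 2 * ξ → K + (m + 2 * ξ) ≡ 2 * n → m + ξ ≤ n →
  8 * (n * n) < 45 * tᵥ → 5 * tᵥ ≤ 2 * (ξ * ξ + E * E) → 2 * tᵥ ≤ ξ * ξ →
  8 * (n * n) < 45 * tᵤ → 2 * tᵤ ≤ K * (2 * h + m) →
  5 * (8 * (n * n)) < 45 * tᵣ → 2 * tᵣ ≤ K * (4 * ξ + 4 * m) → ⊥
link-sizes-incompatible n ξ h K m E tᵥ tᵤ tᵣ E-def K-def m+ξ≤n denseᵥ tᵥ≤ mantel denseᵤ tᵤ≤ denseᵣ tᵣ≤ =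
  parameters-incompatible n ξ h K m E E-def K-def m+ξ≤n link-v (double-< (n * n) tᵤ _ denseᵤ tᵤ≤) link-rim (double-< (n * n) tᵥ _ denseᵥ mantel)
  where
  open ≤-Reasoning
  link-v : 4 * (n * n) < 9 * (ξ * ξ + E * E)
  link-v = *-cancelˡ-< 2 (4 * (n * n)) (9 * (ξ * ξ + E * E)) (begin-strict
    2 * (4 * (n * n))         ≡⟨ *-assoc 2 4 (n * n) ⟨
    8 * (n * n)               <⟨ denseᵥ ⟩
    45 * tᵥ                   ≡⟨ *-assoc 9 5 tᵥ ⟩
    9 * (5 * tᵥ)              ≤⟨ *-monoʳ-≤ 9 tᵥ≤ ⟩
    9 * (2 * (ξ * ξ + E * E)) ≡⟨ eq (ξ * ξ + E * E) ⟩
    2 * (9 * (ξ * ξ + E * E)) ∎)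
    where
    eq : ∀ s → 9 * (2 * s) ≡ 2 * (9 * s)
    eq = solve-∀

  link-rim : 4 * (n * n) < 9 * (K * (ξ + m))
  link-rim = *-cancelˡ-< 20 (4 * (n * n)) (9 * (K * (ξ + m))) (begin-strict
    20 * (4 * (n * n))        ≡⟨ eq₁ (n * n) ⟩
    2 * (5 * (8 * (n * n)))   <⟨ *-monoʳ-< 2 denseᵣ ⟩
    2 * (45 * tᵣ)             ≡⟨ eq₂ tᵣ ⟩
    45 * (2 * tᵣ)             ≤⟨ *-monoʳ-≤ 45 tᵣ≤ ⟩
    45 * (K * (4 * ξ + 4 * m)) ≡⟨ eq₃ K ξ m ⟩
    20 * (9 * (K * (ξ + m)))  ∎)
    where
    eq₁ : ∀ a → 20 * (4 * a) ≡ 2 * (5 * (8 * a))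
    eq₁ = solve-∀
    eq₂ : ∀ a → 2 * (45 * a) ≡ 45 * (2 * a)
    eq₂ = solve-∀
    eq₃ : ∀ a b c → 45 * (a * (4 * b + 4 * c)) ≡ 20 * (9 * (a * (b + c)))
    eq₃ = solve-∀

-- Since 45 ≤ 7², the irrational bound on d relaxes to 4n/7, which is what the seven vertices of a
-- spindle need.
square-< : ∀ n d → 16 * (n * n) < 45 * (d * d) → 4 * n < 7 * d
square-< n d less with 4 * n <? 7 * d
... | yes 4n<7d = 4n<7d
... | no ¬less = ⊥-elim (<-irrefl refl (begin-strict
  16 * (n * n)          <⟨ less ⟩
  45 * (d * d)          ≤⟨ *-monoˡ-≤ (d * d) (m≤m+n 45 4) ⟩
  49 * (d * d)          ≡⟨ square₇ d ⟩
  7 * d * (7 * d)       ≤⟨ *-mono-≤ (≮⇒≥ ¬less) (≮⇒≥ ¬less) ⟩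
  4 * n * (4 * n)       ≡⟨ square₄ n ⟩
  16 * (n * n)          ∎))
  where
  open ≤-Reasoning
  square₇ : ∀ d → 49 * (d * d) ≡ 7 * d * (7 * d)
  square₇ = solve-∀
  square₄ : ∀ d → 4 * d * (4 * d) ≡ 16 * (d * d)
  square₄ = solve-∀

module _ (G : K₄FreeGraph n) (dense : Dense G) where
  open K₄FreeGraph G

  link-mantel : ∀ v → 2 * triangles v ≤ count (adj v) * count (adj v)
  link-mantel v = ≤-trans (turán adj adj-sym 1 (adj v) triangle-free) (≤-reflexive (*-identityˡ (count (adj v) * count (adj v))))
    where
    triangle-free : ω≤ adj 2 (adj v)
    triangle-free x v∼x y Ny z Nz =
      let v∼y , x∼y = ∧-true {adj v y} Ny
          vx∼z , y∼z = ∧-true {adj v z ∧ adj x z} Nz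
          v∼z , x∼z = ∧-true {adj v z} vx∼z
      in no-K₄ v∼x v∼y v∼z x∼y x∼z y∼z

  degree-bound : ∀ v → 4 * n < 7 * count (adj v)
  degree-bound v = square-< n (count (adj v)) (double-< (n * n) (triangles v) (count (adj v) * count (adj v)) (dense v) (link-mantel v))

  optimal-wheel-impossible : ∀ v (R : Wheel.Rim G v) → Wheel.Rim.Optimal R →
    (M : Matchings.Matching G (Wheel.Y G v)) → Matchings.Matching.Maximal M →
    ∀ u → v ∼ u → (∀ z → v ∼ z → Wheel.p G v u ≤ Wheel.p G v z) → ⊥
  optimal-wheel-impossible v R optimal M maximal u v∼u min
    with E , 5h+E ← m≤n⇒∃[o]m+o≡n (Wheel.5h≤2ξ G v R (Wheel.p G v u) min) =
    link-sizes-incompatible n ξ (p u) K size E (triangles v) (triangles u) (sum (triangles ∘ c)) E-def K-def m+ξ≤n (dense v) (hub-link R (p u) min optimal {E} E-def) (link-mantel v)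
      (dense u) (link-in-X R M maximal u v∼u) rim-dense (rim-links R M maximal)
    where
    open Wheel G v
    open Rim R using (c)
    open Matchings.Matching M using (K; size; K+size; size≤)

    E-def : E + 5 * p u ≡ 2 * ξ
    E-def = trans (+-comm E (5 * p u)) 5h+E

    Y+ξ : count Y + ξ ≡ n
    Y+ξ = trans (sym (∑-distrib-+ (⟦_⟧ ∘ Y) (⟦_⟧ ∘ X))) (trans (sum-cong-≗ one) (trans (sum-const n 1) (*-identityʳ n)))
      where
      one : ∀ x → ⟦ Y x ⟧ + ⟦ X x ⟧ ≡ 1
      one x with X x
      ... | true  = refl
      ... | false = refl

    K-def : K + (size + 2 * ξ) ≡ 2 * n
    K-def = trans (sym (+-assoc K size (2 * ξ))) (trans (cong (_+ 2 * ξ) K+size) (trans (collect (count Y) ξ) (cong (2 *_) Y+ξ)))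
      where
      collect : ∀ y x → y + y + 2 * x ≡ 2 * (y + x)
      collect = solve-∀

    m+ξ≤n : size + ξ ≤ n
    m+ξ≤n = ≤-trans (+-monoˡ-≤ ξ size≤) (≤-reflexive Y+ξ)

    rim-dense : 5 * (8 * (n * n)) < 45 * sum (triangles ∘ c)
    rim-dense = subst₂ _<_ (sum-const 5 (8 * (n * n))) (sum-scale 45 (triangles ∘ c))
      (sum-mono-< (λ i → <⇒≤ (dense (c i))) 0F (dense (c 0F)))

  no-wheel : ∀ v → ¬ Wheel.Rim G v
  -- N(v) is nonempty because it contains the rim, so it has a vertex of minimum degree.
  no-wheel v R₀ = [ (λ none → none _ (Rim.hub R₀ 0F)) , at-minimum (optimal-rim R₀) (Matchings.maximal-matching G Y) ]′
    (extremum _≥_ ≤-refl (flip ≤-trans) (flip ≤-total) X p)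
    where
    open Wheel G v
    at-minimum : ∃ Rim.Optimal → ∃ Matchings.Matching.Maximal → (∃[ u ] v ∼ u × (∀ z → v ∼ z → p u ≤ p z)) → ⊥
    at-minimum (R , optimal) (M , maximal) (u , v∼u , min) = optimal-wheel-impossible v R optimal M maximal u v∼u min

  -- x, p, q, y₁, y₂, r, s form a Moser spindle, degenerate if pq and rs intersect.
  no-spindle : ∀ {x y₁ y₂ p q r s} → y₁ ∼ y₂ → x ∼ p → x ∼ q → y₁ ∼ p → y₁ ∼ q → p ∼ q →
    x ∼ r → x ∼ s → y₂ ∼ r → y₂ ∼ s → r ∼ s → ⊥
  no-spindle {x} {y₁} {y₂} {p} {q} {r} {s} y₁y₂ xp xq y₁p y₁q pq xr xs y₂r y₂s rs
    -- Such a z is the hub of a wheel whose rim is x, one of p and q, y₁, y₂, one of r and s.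
    with any? (λ z → (adj x z ≟ᵇ true) ×-dec (adj y₁ z ≟ᵇ true) ×-dec (adj y₂ z ≟ᵇ true) ×-dec
                     ((adj p z ≟ᵇ true) ⊎-dec (adj q z ≟ᵇ true)) ×-dec ((adj r z ≟ᵇ true) ⊎-dec (adj s z ≟ᵇ true)))
  ... | yes (z , zx , zy₁ , zy₂ , pq-side , rs-side) = no-wheel z (wheel pq-side rs-side)
    where
    rim-through : ∀ {p r} → x ∼ p → p ∼ y₁ → y₂ ∼ r → r ∼ x → p ∼ z → r ∼ z → Wheel.Rim G z
    rim-through {p} {r} xp py₁ y₂r rx pz rz = record
      { c   = λ { 0F → x ; 1F → p ; 2F → y₁ ; 3F → y₂ ; 4F → r }
      ; hub = λ { 0F → ∼-sym zx ; 1F → ∼-sym pz ; 2F → ∼-sym zy₁ ; 3F → ∼-sym zy₂ ; 4F → ∼-sym rz }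
      ; rim = λ { 0F → xp ; 1F → py₁ ; 2F → y₁y₂ ; 3F → y₂r ; 4F → rx } }
    wheel : p ∼ z ⊎ q ∼ z → r ∼ z ⊎ s ∼ z → Wheel.Rim G z
    wheel (inj₁ pz) (inj₁ rz) = rim-through xp (∼-sym y₁p) y₂r (∼-sym xr) pz rz
    wheel (inj₁ pz) (inj₂ sz) = rim-through xp (∼-sym y₁p) y₂s (∼-sym xs) pz sz
    wheel (inj₂ qz) (inj₁ rz) = rim-through xq (∼-sym y₁q) y₂r (∼-sym xr) qz rz
    wheel (inj₂ qz) (inj₂ sz) = rim-through xq (∼-sym y₁q) y₂s (∼-sym xs) qz sz
  -- Double counting: the seven degrees add up to more than 4n, while no z sees more than four of
  -- the seven vertices.
  ... | no none = <-irrefl refl (begin-strict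
    7 * (4 * n)                                ≡⟨ sum-const 7 (4 * n) ⟨
    sum {7} (λ _ → 4 * n)                      <⟨ sum-mono-< {7} (λ i → <⇒≤ (degree-bound (u i))) 0F (degree-bound (u 0F)) ⟩
    sum (λ i → 7 * count (adj (u i)))          ≡⟨ sum-scale {7} 7 (λ i → count (adj (u i))) ⟩
    7 * sum (λ i → count (adj (u i)))          ≡⟨ cong (7 *_) (∑-comm {7} (λ i z → ⟦ adj (u i) z ⟧)) ⟩
    7 * sum (λ z → count (λ i → adj (u i) z))  ≤⟨ *-monoʳ-≤ 7 (sum-mono-≤ at-most-four) ⟩
    7 * sum {n} (λ _ → 4)                      ≡⟨ cong (7 *_) (trans (sum-const n 4) (*-comm n 4)) ⟩
    7 * (4 * n)                                ∎)
    where
    open ≤-Reasoning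
    u : Fin 7 → Fin n
    u 0F = x
    u 1F = y₁
    u 2F = y₂
    u 3F = p
    u 4F = q
    u 5F = r
    u 6F = s

    -- z misses a vertex of each of four triangles and is no hub. Two misses meet all four triangles
    -- only as one of p, q and one of r, s, and then z would be a hub.
    premise : BoolFun 7
    premise x y₁ y₂ p q r s = not (x ∧ p ∧ q) ∧ not (y₁ ∧ p ∧ q) ∧ not (x ∧ r ∧ s) ∧ not (y₂ ∧ r ∧ s)
      ∧ not (x ∧ y₁ ∧ y₂ ∧ (p ∨ q) ∧ (r ∨ s))

    not-true : ∀ {b} → ¬ b ≡ true → not b ≡ true
    not-true ¬b = cong not (¬-not ¬b)

    ∨-true : ∀ {a b} → a ∨ b ≡ true → a ≡ true ⊎ b ≡ true
    ∨-true {true}  _ = inj₁ refl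
    ∨-true {false} b = inj₂ b

    triangle : ∀ {a b c z} → a ∼ b → a ∼ c → b ∼ c → not (adj a z ∧ adj b z ∧ adj c z) ≡ true
    triangle {a} {b} {c} {z} ab ac bc = not-true λ eq →
      let az , eq′ = ∧-true {adj a z} eq
          bz , cz  = ∧-true {adj b z} eq′
      in no-K₄ ab ac az bc bz cz

    at-most-four : ∀ z → count (λ i → adj (u i) z) ≤ 4
    at-most-four z = ≤ᵇ⇒≤ _ _ (implies (check 7
      (λ x y₁ y₂ p q r s → not (premise x y₁ y₂ p q r s) ∨ (⟦ x ⟧ + (⟦ y₁ ⟧ + (⟦ y₂ ⟧ + (⟦ p ⟧ + (⟦ q ⟧ + (⟦ r ⟧ + (⟦ s ⟧ + 0)))))) ≤ᵇ 4)) _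
      (adj x z) (adj y₁ z) (adj y₂ z) (adj p z) (adj q z) (adj r z) (adj s z))
      (∧-intro (triangle xp xq pq) (∧-intro (triangle y₁p y₁q pq) (∧-intro (triangle xr xs rs) (∧-intro (triangle y₂r y₂s rs) no-hub)))))
      where
      no-hub : not (adj x z ∧ adj y₁ z ∧ adj y₂ z ∧ (adj p z ∨ adj q z) ∧ (adj r z ∨ adj s z)) ≡ true
      no-hub = not-true λ eq →
        let xz , eq₁  = ∧-true {adj x z} eq
            y₁z , eq₂ = ∧-true {adj y₁ z} eq₁
            y₂z , eq₃ = ∧-true {adj y₂ z} eq₂
            pqz , rsz = ∧-true {adj p z ∨ adj q z} eq₃
        in none (z , xz , y₁z , y₂z , ∨-true pqz , ∨-true rsz)

-- Saturation

true-⇔ : ∀ {a b} → (a ≡ true → b ≡ true) → (b ≡ true → a ≡ true) → a ≡ b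
true-⇔ {true}  {true}  _ _ = refl
true-⇔ {true}  {false} f _ = sym (f refl)
true-⇔ {false} {true}  _ g = g refl
true-⇔ {false} {false} _ _ = refl

does-true : {A : Set} (A? : Dec A) → does A? ≡ true → A
does-true (yes a) _ = a

-- The obstruction to joining `a` and `b`: with the edge pq they would span a K₄.
CommonEdge : K₄FreeGraph n → Fin n → Fin n → Set
CommonEdge G a b = ∃[ p ] ∃[ q ] (a ∼ p × a ∼ q × b ∼ p × b ∼ q × p ∼ q)
  where open K₄FreeGraph G

commonEdge? : (G : K₄FreeGraph n) → ∀ a b → Dec (CommonEdge G a b)
commonEdge? G a b = any? λ p → any? λ q → (adj a p ≟ᵇ true) ×-dec (adj a q ≟ᵇ true) ×-dec
  (adj b p ≟ᵇ true) ×-dec (adj b q ≟ᵇ true) ×-dec (adj p q ≟ᵇ true)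
  where open K₄FreeGraph G

module AddEdge (G : K₄FreeGraph n) {a b : Fin n} (a≢b : a ≢ b)
  (no-edge : ¬ CommonEdge G a b) where
  open K₄FreeGraph G

  private
    added? : ∀ x y → Dec (x ∼ y ⊎ (x ≡ a × y ≡ b) ⊎ (x ≡ b × y ≡ a))
    added? x y = (adj x y ≟ᵇ true) ⊎-dec ((x ≟ a) ×-dec (y ≟ b)) ⊎-dec ((x ≟ b) ×-dec (y ≟ a))

  adj⁺ : Relation n
  adj⁺ x y = does (added? x y)

  intro : ∀ {x y} → x ∼ y ⊎ (x ≡ a × y ≡ b) ⊎ (x ≡ b × y ≡ a) → adj⁺ x y ≡ true
  intro {x} {y} = dec-true (added? x y)

  private
    elim : ∀ {x y} → adj⁺ x y ≡ true → x ∼ y ⊎ (x ≡ a × y ≡ b) ⊎ (x ≡ b × y ≡ a)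
    elim {x} {y} = does-true (added? x y)

    flip⁺ : ∀ {x y} → adj⁺ x y ≡ true → adj⁺ y x ≡ true
    flip⁺ {x} {y} e with elim {x} {y} e
    ... | inj₁ x∼y              = intro (inj₁ (∼-sym x∼y))
    ... | inj₂ (inj₁ (eq , eq′)) = intro (inj₂ (inj₂ (eq′ , eq)))
    ... | inj₂ (inj₂ (eq , eq′)) = intro (inj₂ (inj₁ (eq′ , eq)))

    no-loop : ∀ {x} → adj⁺ x x ≡ true → ⊥
    no-loop {x} e with elim {x} {x} e
    ... | inj₁ x∼x                 = irrefl x∼x
    ... | inj₂ (inj₁ (refl , a≡b)) = a≢b a≡b
    ... | inj₂ (inj₂ (refl , b≡a)) = a≢b (sym b≡a)

    spoke : ∀ {p} → adj⁺ a p ≡ true → adj⁺ b p ≡ true → a ∼ p × b ∼ p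
    spoke {p} ap bp with elim {a} {p} ap | elim {b} {p} bp
    ... | inj₁ a∼p                  | inj₁ b∼p                  = a∼p , b∼p
    ... | inj₂ (inj₁ (_ , refl))    | _                         = ⊥-elim (no-loop {b} bp)
    ... | inj₂ (inj₂ (a≡b , _))     | _                         = ⊥-elim (a≢b a≡b)
    ... | inj₁ _                    | inj₂ (inj₁ (b≡a , _))     = ⊥-elim (a≢b (sym b≡a))
    ... | inj₁ _                    | inj₂ (inj₂ (_ , refl))    = ⊥-elim (no-loop {a} ap)

    new-edge : ∀ {p q} → adj⁺ a p ≡ true → adj⁺ a q ≡ true → adj⁺ b p ≡ true → adj⁺ b q ≡ true → adj⁺ p q ≡ true → ⊥
    new-edge {p} {q} ap aq bp bq pq with elim {p} {q} pq
    ... | inj₂ (inj₁ (refl , _)) = no-loop {a} ap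
    ... | inj₂ (inj₂ (refl , _)) = no-loop {b} bp
    ... | inj₁ p∼q = let a∼p , b∼p = spoke ap bp ; a∼q , b∼q = spoke aq bq in no-edge (p , q , a∼p , a∼q , b∼p , b∼q , p∼q)

    -- If an edge st of a K₄ were the added one, the opposite edge pq would be a common edge of its
    -- ends.
    old : ∀ {s t p q} → adj⁺ s t ≡ true → adj⁺ s p ≡ true → adj⁺ s q ≡ true → adj⁺ t p ≡ true → adj⁺ t q ≡ true →
      adj⁺ p q ≡ true → s ∼ t
    old {s} {t} st sp sq tp tq pq with elim {s} {t} st
    ... | inj₁ s∼t = s∼t
    ... | inj₂ (inj₁ (refl , refl)) = ⊥-elim (new-edge sp sq tp tq pq)
    ... | inj₂ (inj₂ (refl , refl)) = ⊥-elim (new-edge tp tq sp sq pq)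

  G⁺ : K₄FreeGraph n
  G⁺ .K₄FreeGraph.adj = adj⁺
  G⁺ .K₄FreeGraph.adj-sym x y = true-⇔ (flip⁺ {x} {y}) (flip⁺ {y} {x})
  G⁺ .K₄FreeGraph.no-K₄ {s} {t} {p} {q} st sp sq tp tq pq = no-K₄
    (old st sp sq tp tq pq) (old sp st sq (flip⁺ {t} tp) pq tq) (old sq st sp (flip⁺ {t} tq) (flip⁺ {p} pq) tp)
    (old tp (flip⁺ {s} st) tq (flip⁺ {s} sp) pq sq) (old tq (flip⁺ {s} st) tp (flip⁺ {s} sq) (flip⁺ {p} pq) sp)
    (old pq (flip⁺ {s} sp) (flip⁺ {t} tp) (flip⁺ {s} sq) (flip⁺ {t} tq) st)

  larger : ¬ a ∼ b → ∑∑ (λ x y → ⟦ adj x y ⟧) < ∑∑ (λ x y → ⟦ adj⁺ x y ⟧)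
  larger a≁b = sum-mono-< (λ x → sum-mono-≤ (pointwise x)) a (sum-mono-< (pointwise a) b strict)
    where
    pointwise : ∀ x y → ⟦ adj x y ⟧ ≤ ⟦ adj⁺ x y ⟧
    pointwise x y = ⟦⟧-mono λ x∼y → intro (inj₁ x∼y)
    strict : ⟦ adj a b ⟧ < ⟦ adj⁺ a b ⟧
    strict = subst₂ (λ s t → ⟦ s ⟧ < ⟦ t ⟧) (sym (¬-not a≁b)) (sym (intro {a} {b} (inj₂ (inj₁ (refl , refl))))) z<s

Colouring : Relation n → Set
Colouring {n} R = Σ[ part ∈ (Fin n → Fin 3) ] (∀ x y → R x y ≡ true → part x ≢ part y)

module _ (G : K₄FreeGraph n) where
  open K₄FreeGraph G

  Saturated : Set
  Saturated = ∀ a b → a ≢ b → ¬ a ∼ b → CommonEdge G a b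

  -- The colour classes are the non-neighbours of x₀, x₁ and x₂: a common neighbour of x₀ and x₁ is
  -- not joined to x₂, as there is no K₄.
  multipartite-colouring : (∀ {x y z} → ¬ x ∼ y → ¬ x ∼ z → ¬ y ∼ z) → ∀ {x₀ x₁ x₂} → x₀ ∼ x₁ → x₀ ∼ x₂ → x₁ ∼ x₂ → Colouring adj
  multipartite-colouring ≁-trans {x₀} {x₁} {x₂} e₀₁ e₀₂ e₁₂ = part , proper
    where
    part : Fin n → Fin 3
    part z with adj x₀ z | adj x₁ z
    ... | false | _     = 0F
    ... | true  | false = 1F
    ... | true  | true  = 2F

    ≁ : ∀ {x y} → adj x y ≡ false → ¬ x ∼ y
    ≁ eq eq′ with () ← trans (sym eq) eq′

    proper : ∀ y z → y ∼ z → part y ≢ part z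
    proper y z y∼z with adj x₀ y in y₀ | adj x₁ y in y₁ | adj x₀ z in z₀ | adj x₁ z in z₁
    ... | false | _     | false | _     = λ _ → ≁-trans (≁ y₀) (≁ z₀) y∼z
    ... | true  | false | true  | false = λ _ → ≁-trans (≁ y₁) (≁ z₁) y∼z
    ... | true  | true  | true  | true  = λ _ → ≁-trans (no-K₄ e₀₁ e₀₂ y₀ e₁₂ y₁) (no-K₄ e₀₁ e₀₂ z₀ e₁₂ z₁) y∼z
    ... | false | _     | true  | false = λ ()
    ... | false | _     | true  | true  = λ ()
    ... | true  | false | false | _     = λ ()
    ... | true  | true  | false | _     = λ ()
    ... | true  | false | true  | true  = λ ()
    ... | true  | true  | true  | false = λ ()

  saturated-colouring : Fin n → Dense G → Saturated → Colouring adj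
  saturated-colouring x₀ dense saturated with sum-positive _ (positive x₀)
    where
    positive : ∀ v → 0 < triangles v
    positive v with triangles v in eq
    ... | suc _ = z<s
    ... | zero  = ⊥-elim (n≮0 (subst (8 * (n * n) <_) (trans (cong (45 *_) eq) (*-zeroʳ 45)) (dense v)))
  ... | x₁ , 0<row with sum-positive _ 0<row
  ... | x₂ , 0<entry with ∧-true {adj x₀ x₁} (⟦⟧-positive 0<entry)
  ... | e₀₁ , eq with ∧-true {adj x₀ x₂} eq
  ... | e₀₂ , e₁₂ = multipartite-colouring ≁-trans e₀₁ e₀₂ e₁₂
    where
    -- If y ∼ z, saturation at xy and at xz provides the edges pq and rs that complete a spindle.
    ≁-trans : ∀ {x y z} → ¬ x ∼ y → ¬ x ∼ z → ¬ y ∼ z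
    ≁-trans {x} {y} {z} x≁y x≁z y∼z =
      let p , q , xp , xq , yp , yq , pq = saturated x y (λ { refl → x≁z y∼z }) x≁y
          r , s , xr , xs , zr , zs , rs = saturated x z (λ { refl → x≁y (∼-sym y∼z) }) x≁z
      in no-spindle G dense y∼z xp xq yp yq pq xr xs zr zs rs

-- A saturated supergraph has at least as many triangles at each vertex, so it stays dense, and its
-- colouring also colours `G`.
dense-colouring : (G : K₄FreeGraph n) → Fin n → Dense G → Colouring (K₄FreeGraph.adj G)
dense-colouring {n} G x₀ dense = restrict (ascend size (n * n) size≤ improve (G , λ _ _ e → e))
  where
  open K₄FreeGraph using (adj)

  Super : Set
  Super = Σ[ H ∈ K₄FreeGraph n ] (∀ x y → adj G x y ≡ true → adj H x y ≡ true)

  size : Super → ℕ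
  size (H , _) = ∑∑ λ x y → ⟦ adj H x y ⟧

  size≤ : ∀ H → size H ≤ n * n
  size≤ (H , _) = ≤-trans (sum-mono-≤ (λ x → count≤n (adj H x))) (≤-reflexive (sum-const n n))

  improve : ∀ H → (∃[ H′ ] size H < size H′) ⊎ Saturated (proj₁ H)
  improve (H , G⊆H)
    with any? (λ a → any? (λ b → ¬? (a ≟ b) ×-dec ¬? (adj H a b ≟ᵇ true) ×-dec ¬? (commonEdge? H a b)))
  ... | yes (a , b , a≢b , a≁b , none) = inj₁ ((G⁺ , λ x y e → intro (inj₁ (G⊆H x y e))) , larger a≁b)
    where open AddEdge H a≢b none
  ... | no none = inj₂ λ a b a≢b a≁b →
    decidable-stable (commonEdge? H a b) λ ¬common → none (a , b , a≢b , a≁b , ¬common)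

  restrict : ∃ (Saturated ∘ proj₁) → Colouring (adj G)
  restrict ((H , G⊆H) , saturated) =
    let part , proper = saturated-colouring H x₀ dense-H saturated in part , λ x y e → proper x y (G⊆H x y e)
    where
    dense-H : Dense H
    dense-H v = <-≤-trans (dense v) (*-monoʳ-≤ 45 (∑∑-mono-≤ pointwise))
      where
      pointwise : ∀ x y → ⟦ adj G v x ∧ adj G v y ∧ adj G x y ⟧ ≤ ⟦ adj H v x ∧ adj H v y ∧ adj H x y ⟧
      pointwise x y = ⟦⟧-mono λ eq →
        let vx , eq′ = ∧-true {adj G v x} eq
            vy , xy  = ∧-true {adj G v y} eq′
        in cong₂ _∧_ (G⊆H v x vx) (cong₂ _∧_ (G⊆H v y vy) (G⊆H x y xy))

-- The shadow of a cancellative 3-graph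

everything : Fin n → Bool
everything _ = true

count-everything : ∀ n → count {n} everything ≡ n
count-everything n = trans (sum-const n 1) (*-identityʳ n)

count-unique : (b : Fin k → Bool) (a : Bool) → (∀ i → b i ≡ true → a ≡ true) →
  (∀ i j → i ≢ j → b i ≡ true → b j ≡ true → ⊥) → count b ≤ ⟦ a ⟧
count-unique {zero}  b a _   _      = z≤n
count-unique {suc k} b a b⇒a unique with b zero in b₀
... | false = count-unique (b ∘ suc) a (b⇒a ∘ suc) λ i j i≢j → unique (suc i) (suc j) (i≢j ∘ suc-injective)
... | true rewrite b⇒a zero b₀ = ≤-reflexive (cong suc (sum-zero λ j → cong ⟦_⟧ (¬-not (unique zero (suc j) (λ ()) b₀))))

Clique : Relation n → (Fin k → Fin n) → Set
Clique R U = ∀ i j → i ≢ j → R (U i) (U j) ≡ true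

clique-∷ : {R : Relation n} → (∀ x y → R x y ≡ R y x) → ∀ {x} {U : Fin k → Fin n} →
  (∀ j → R x (U j) ≡ true) → Clique R U → Clique R (x Vector.∷ U)
clique-∷ R-sym xU U-clique zero    zero    0≢0 = ⊥-elim (0≢0 refl)
clique-∷ R-sym xU U-clique zero    (suc j) _   = xU j
clique-∷ R-sym xU U-clique (suc i) zero    _   = trans (R-sym _ _) (xU i)
clique-∷ R-sym xU U-clique (suc i) (suc j) i≢j = U-clique i j (i≢j ∘ cong suc)

clique-[] : {R : Relation n} → Clique {k = 0} R Vector.[]
clique-[] ()

-- Unrolls the recursive `ω≤` into an explicit clique that gains one vertex per step.
no-clique⇒ω≤ : (R : Relation n) → (∀ x y → R x y ≡ R y x) → ∀ k (S : Fin n → Bool) →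
  (∀ (U : Fin (suc k) → Fin n) → (∀ i → S (U i) ≡ true) → ¬ Clique R U) → ω≤ R k S
no-clique⇒ω≤ R R-sym zero S none x Sx =
  none (x Vector.∷ Vector.[]) (λ { zero → Sx }) (clique-∷ {R = R} R-sym (λ ()) (clique-[] {R = R}))
no-clique⇒ω≤ R R-sym (suc k) S none x Sx = no-clique⇒ω≤ R R-sym k (neighbours R S x) λ U U∈ U-clique →
  none (x Vector.∷ U) (λ { zero → Sx ; (suc i) → proj₁ (∧-true {S (U i)} (U∈ i)) })
    (clique-∷ {R = R} R-sym (λ j → proj₂ (∧-true {S (U j)} (U∈ j))) U-clique)

length-filterᵇ-map : ∀ {A B : Set} (p : B → Bool) (f : A → B) (g : Fin k → A) →
  length (filterᵇ p (map f (tabulate g))) ≡ count (p ∘ f ∘ g)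
length-filterᵇ-map {zero}  p f g = refl
length-filterᵇ-map {suc k} p f g with p (f (g zero))
... | true  = cong suc (length-filterᵇ-map p f (g ∘ suc))
... | false = length-filterᵇ-map p f (g ∘ suc)

length-filterᵇ-concatMap : ∀ {A B : Set} (p : B → Bool) (f : A → List B) (g : Fin k → A) →
  length (filterᵇ p (concatMap f (tabulate g))) ≡ sum (λ i → length (filterᵇ p (f (g i))))
length-filterᵇ-concatMap {zero}  p f g = refl
length-filterᵇ-concatMap {suc k} p f g =
  trans (cong length (filter-++ (T? ∘ p) (f (g zero)) (concatMap f (tabulate (g ∘ suc)))))
    (trans (length-++ (filterᵇ p (f (g zero)))) (cong (length (filterᵇ p (f (g zero))) +_) (length-filterᵇ-concatMap p f (g ∘ suc))))

module _ (H : ThreeGraph n) where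

  linkSize : Fin n → ℕ
  linkSize v = ∑∑ λ x y → ⟦ edge H v x y ⟧

  degree-sum : ∀ v → degree H v ≡ ∑∑ λ x y → ⟦ (toℕ x <ᵇ toℕ y) ∧ edge H v x y ⟧
  degree-sum v = trans (length-filterᵇ-concatMap {n} ok (λ u → map (u ,_) (allFin n)) id)
    (sum-cong-≗ {n} λ u → length-filterᵇ-map {n} ok (u ,_) id)
    where
    ok : Fin n × Fin n → Bool
    ok p = (toℕ (proj₁ p) <ᵇ toℕ (proj₂ p)) ∧ edge H v (proj₁ p) (proj₂ p)

  2degree≤linkSize : ∀ v → 2 * degree H v ≤ linkSize v
  2degree≤linkSize v = begin
    2 * degree H v                       ≡⟨ cong (2 *_) (degree-sum v) ⟩
    2 * ∑∑ up                            ≡⟨ cong (∑∑ up +_) (trans (+-identityʳ (∑∑ up)) (∑-comm up)) ⟩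
    ∑∑ up + ∑∑ (λ x y → up y x)          ≡⟨ ∑∑-+ up (λ x y → up y x) ⟨
    ∑∑ (λ x y → up x y + up y x)         ≤⟨ ∑∑-mono-≤ pointwise ⟩
    linkSize v                           ∎
    where
    open ≤-Reasoning
    up : Fin n → Fin n → ℕ
    up x y = ⟦ (toℕ x <ᵇ toℕ y) ∧ edge H v x y ⟧

    asymmetric : ∀ k l → (k <ᵇ l) ≡ true → (l <ᵇ k) ≡ false
    asymmetric zero    (suc l) _  = refl
    asymmetric (suc k) (suc l) lt = asymmetric k l lt

    pointwise : ∀ x y → up x y + up y x ≤ ⟦ edge H v x y ⟧
    pointwise x y rewrite sym₂₃ H v y x with edge H v x y
    ... | false rewrite ∧-zeroʳ (toℕ x <ᵇ toℕ y) | ∧-zeroʳ (toℕ y <ᵇ toℕ x) = z≤n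
    ... | true with toℕ x <ᵇ toℕ y in lt
    ...   | true rewrite asymmetric (toℕ x) (toℕ y) lt = ≤-refl
    ...   | false with toℕ y <ᵇ toℕ x
    ...     | true  = ≤-refl
    ...     | false = z≤n

  swap₁₂ : ∀ {a b c} → IsEdge H a b c → IsEdge H b a c
  swap₁₂ {a} {b} {c} e = trans (sym₁₂ H b a c) e

  swap₂₃ : ∀ {a b c} → IsEdge H a b c → IsEdge H a c b
  swap₂₃ {a} {b} {c} e = trans (sym₂₃ H a c b) e

  covered? : ∀ x y → Dec (∃[ z ] IsEdge H x y z)
  covered? x y = any? λ z → edge H x y z ≟ᵇ true

  shadow : Relation n
  shadow x y = does (covered? x y)

  shadow-intro : ∀ {x y z} → IsEdge H x y z → shadow x y ≡ true
  shadow-intro {x} {y} {z} e = dec-true (covered? x y) (z , e)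

  shadow-elim : ∀ {x y} → shadow x y ≡ true → ∃[ z ] IsEdge H x y z
  shadow-elim {x} {y} = does-true (covered? x y)

  shadow-sym : ∀ x y → shadow x y ≡ shadow y x
  shadow-sym x y = true-⇔ (symmetric x y) (symmetric y x)
    where
    symmetric : ∀ x y → shadow x y ≡ true → shadow y x ≡ true
    symmetric x y s = let z , e = shadow-elim {x} {y} s in shadow-intro (swap₁₂ e)

  shadow-∷ : ∀ {x} {U : Fin k → Fin n} → (∀ j → shadow x (U j) ≡ true) → Clique shadow U → Clique shadow (x Vector.∷ U)
  shadow-∷ = clique-∷ {R = shadow} shadow-sym

  -- The union of the links of the vertices U i.
  module Rainbow (U : Fin k → Fin n) where

    coloured? : ∀ x y → Dec (∃[ i ] IsEdge H (U i) x y)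
    coloured? x y = any? λ i → edge H (U i) x y ≟ᵇ true

    rainbow : Relation n
    rainbow x y = does (coloured? x y)

    colour : ∀ {x y} → rainbow x y ≡ true → ∃[ i ] IsEdge H (U i) x y
    colour {x} {y} = does-true (coloured? x y)

    rainbow-sym : ∀ x y → rainbow x y ≡ rainbow y x
    rainbow-sym x y = true-⇔ (symmetric x y) (symmetric y x)
      where
      symmetric : ∀ x y → rainbow x y ≡ true → rainbow y x ≡ true
      symmetric x y r = let i , e = colour {x} {y} r in dec-true (coloured? y x) (i , swap₂₃ e)

    rainbow⇒shadow : ∀ {x y} → rainbow x y ≡ true → shadow x y ≡ true
    rainbow⇒shadow {x} {y} r = let i , e = colour {x} {y} r in shadow-intro (swap₂₃ (swap₁₂ e))

  module _ (free : K4minusF5Free H) where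

    -- Let abe be an edge over the shadow pair ab. If e is x or y, the three edges form K₄⁻,
    -- otherwise F₅.
    cancellative : ∀ {x y a b} → IsEdge H x y a → IsEdge H x y b → shadow a b ≡ true → ⊥
    cancellative {x} {y} {a} {b} xya xyb ab
      with e , abe ← shadow-elim {a} {b} ab
      with x≢y , y≢a , x≢a ← distinct H x y a xya
      with _ , y≢b , x≢b ← distinct H x y b xyb
      with a≢b , b≢e , a≢e ← distinct H a b e abe
      with e ≟ x | e ≟ y
    ... | yes refl | _ = proj₁ free (x , y , a , b , (x≢y , x≢a , x≢b , y≢a , y≢b , a≢b) , xya , xyb , swap₁₂ (swap₂₃ abe))
    ... | no _ | yes refl = proj₁ free (y , x , a , b , (x≢y ∘ sym , y≢a , y≢b , x≢a , x≢b , a≢b) ,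
      swap₁₂ xya , swap₁₂ xyb , swap₁₂ (swap₂₃ abe))
    ... | no e≢x | no e≢y = proj₂ free (x , y , a , b , e ,
      (x≢y , x≢a , x≢b , e≢x ∘ sym , y≢a , y≢b , e≢y ∘ sym , a≢b , a≢e , b≢e) , xya , xyb , abe)

    module _ (large : ∀ v → 4 * (n * n) < 45 * degree H v) where

      linkSize-large : ∀ v → 8 * (n * n) < 45 * linkSize v
      linkSize-large v = begin-strict
        8 * (n * n)             ≡⟨ *-assoc 2 4 (n * n) ⟩
        2 * (4 * (n * n))       <⟨ *-monoʳ-< 2 (large v) ⟩
        2 * (45 * degree H v)   ≡⟨ eq (degree H v) ⟩
        45 * (2 * degree H v)   ≤⟨ *-monoʳ-≤ 45 (2degree≤linkSize v) ⟩
        45 * linkSize v         ∎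
        where
        open ≤-Reasoning
        eq : ∀ d → 2 * (45 * d) ≡ 45 * (2 * d)
        eq = solve-∀

      -- By `cancellative` the links of a shadow clique are disjoint, so their sizes add up inside
      -- the union.
      rainbow-large : (U : Fin (suc k) → Fin n) → Clique shadow U →
        suc k * (8 * (n * n)) < 45 * pairs (Rainbow.rainbow U) everything
      rainbow-large {k} U U-clique = begin-strict
        suc k * (8 * (n * n))                       ≡⟨ sum-const (suc k) (8 * (n * n)) ⟨
        sum {suc k} (λ _ → 8 * (n * n))             <⟨ sum-mono-< (λ i → <⇒≤ (linkSize-large (U i))) zero (linkSize-large (U zero)) ⟩
        sum (λ i → 45 * linkSize (U i))             ≡⟨ sum-scale 45 (linkSize ∘ U) ⟩
        45 * sum (linkSize ∘ U)                     ≡⟨ cong (45 *_) (∑-comm (λ i x → sum (λ y → ⟦ edge H (U i) x y ⟧))) ⟩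
        45 * sum (λ x → sum (λ i → sum (λ y → ⟦ edge H (U i) x y ⟧))) ≡⟨ cong (45 *_) (sum-cong-≗ (λ x → ∑-comm (λ i y → ⟦ edge H (U i) x y ⟧))) ⟩
        45 * ∑∑ (λ x y → count (λ i → edge H (U i) x y)) ≤⟨ *-monoʳ-≤ 45 (∑∑-mono-≤ pointwise) ⟩
        45 * pairs rainbow everything               ∎
        where
        open ≤-Reasoning
        open Rainbow U
        pointwise : ∀ x y → count (λ i → edge H (U i) x y) ≤ ⟦ rainbow x y ⟧
        pointwise x y = count-unique (λ i → edge H (U i) x y) (rainbow x y) (λ i e → dec-true (coloured? x y) (i , e))
          λ i j i≢j e e′ → cancellative (swap₂₃ (swap₁₂ e)) (swap₂₃ (swap₁₂ e′)) (U-clique i j i≢j)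

      -- The union of k + 1 links has density above 8 (k + 1) / 45, and `ratio` says that this
      -- constant is at least r / (s + 1).
      sparse-rainbow : ∀ r s → 45 * r ≤ suc s * (suc k * 8) → (U : Fin (suc k) → Fin n) → Clique shadow U →
        ¬ suc s * pairs (Rainbow.rainbow U) everything ≤ r * (n * n)
      sparse-rainbow {k} r s ratio U U-clique sparse = <-irrefl refl (begin-strict
        suc s * (suc k * (8 * (n * n)))  <⟨ *-monoʳ-< (suc s) (rainbow-large U U-clique) ⟩
        suc s * (45 * P)                 ≡⟨ eq₁ s P ⟩
        45 * (suc s * P)                 ≤⟨ *-monoʳ-≤ 45 sparse ⟩
        45 * (r * (n * n))               ≡⟨ *-assoc 45 r (n * n) ⟨
        45 * r * (n * n)                 ≤⟨ *-monoˡ-≤ (n * n) ratio ⟩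
        suc s * (suc k * 8) * (n * n)    ≡⟨ eq₂ s k (n * n) ⟩
        suc s * (suc k * (8 * (n * n)))  ∎)
        where
        open ≤-Reasoning
        P = pairs (Rainbow.rainbow U) everything
        eq₁ : ∀ s p → suc s * (45 * p) ≡ 45 * (suc s * p)
        eq₁ = solve-∀
        eq₂ : ∀ s k m → suc s * (suc k * 8) * m ≡ suc s * (suc k * (8 * m))
        eq₂ = solve-∀

      no-rainbow-clique : ∀ r → 45 * r ≤ suc r * (suc k * 8) → (U : Fin (suc k) → Fin n) → Clique shadow U →
        ¬ (∀ (V : Fin (suc (suc r)) → Fin n) → ¬ Clique (Rainbow.rainbow U) V)
      no-rainbow-clique r ratio U U-clique none = sparse-rainbow r r ratio U U-clique
        (subst (λ c → suc r * pairs rainbow everything ≤ r * (c * c)) (count-everything n)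
          (turán rainbow rainbow-sym r everything (no-clique⇒ω≤ rainbow rainbow-sym (suc r) everything λ V _ → none V)))
        where open Rainbow U

      no-6-clique : (U : Fin 6 → Fin n) → ¬ Clique shadow U
      -- Six links exceed all n² ordered pairs, as 6 · 8 ≥ 45.
      no-6-clique U U-clique = sparse-rainbow 1 0 (m≤m+n 45 3) U U-clique (begin
        1 * pairs rainbow everything  ≡⟨ *-identityˡ _ ⟩
        pairs rainbow everything      ≤⟨ sum-mono-≤ (λ x → count≤n (rainbow x)) ⟩
        sum {n} (λ _ → n)             ≡⟨ sum-const n n ⟩
        n * n                         ≡⟨ *-identityˡ (n * n) ⟨
        1 * (n * n)                   ∎)
        where
        open ≤-Reasoning
        open Rainbow U

      no-5-clique : (U : Fin 5 → Fin n) → ¬ Clique shadow U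
      -- Turán density 4/5 of K₆-free graphs against five links: 45 · 4 ≤ 5 · 40.
      no-5-clique U U-clique = no-rainbow-clique 4 (m≤m+n 180 20) U U-clique λ V V-clique →
        no-6-clique V λ i j i≢j → Rainbow.rainbow⇒shadow U (V-clique i j i≢j)

      -- Two edges of a rainbow K₄ with the same colour contradict cancellativity if they meet, and form
      -- a 5-clique with their colour if they do not.
      no-4-clique : (U : Fin 4 → Fin n) → ¬ Clique shadow U
      -- Turán density 2/3 of K₄-free graphs against four links: 45 · 2 ≤ 3 · 32.
      no-4-clique U U-clique = no-rainbow-clique 2 (m≤m+n 90 6) U U-clique no-rainbow-K₄
        where
        open Rainbow U
        no-rainbow-K₄ : (V : Fin 4 → Fin n) → ¬ Clique rainbow V
        no-rainbow-K₄ V V-clique = let i , j , i<j , same = pigeonhole (s<s (s<s (s<s (s<s z<s)))) (proj₁ ∘ col)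
          in conflict i j i<j (proj₂ (col i)) (subst (λ c → IsEdge H (U c) (V (source j)) (V (target j))) (sym same) (proj₂ (col j)))
          where
          -- Five edges of the K₄, all but the one joining 2F and 3F, suffice for the pigeonhole on
          -- four colours.
          source target : Fin 5 → Fin 4
          source 0F = 0F
          source 1F = 0F
          source 2F = 0F
          source 3F = 1F
          source 4F = 1F
          target 0F = 1F
          target 1F = 2F
          target 2F = 3F
          target 3F = 2F
          target 4F = 3F

          proper : ∀ i → source i ≢ target i
          proper 0F ()
          proper 1F ()
          proper 2F ()
          proper 3F ()
          proper 4F ()

          col : ∀ i → ∃[ c ] IsEdge H (U c) (V (source i)) (V (target i))
          col i = colour (V-clique (source i) (target i) (proper i))

          adjacent : ∀ i j → i ≢ j → shadow (V i) (V j) ≡ true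
          adjacent i j i≢j = rainbow⇒shadow (V-clique i j i≢j)

          disjoint : ∀ {u x y z w} → IsEdge H u x y → IsEdge H u z w → shadow x y ≡ true → shadow x z ≡ true → shadow x w ≡ true →
            shadow y z ≡ true → shadow y w ≡ true → shadow z w ≡ true → ⊥
          disjoint {u} {x} {y} {z} {w} uxy uzw xy xz xw yz yw zw =
            no-5-clique (u Vector.∷ x Vector.∷ y Vector.∷ z Vector.∷ w Vector.∷ Vector.[])
              (shadow-∷ (λ { 0F → shadow-intro uxy ; 1F → shadow-intro (swap₂₃ uxy) ; 2F → shadow-intro uzw ; 3F → shadow-intro (swap₂₃ uzw) })
                (shadow-∷ (λ { 0F → xy ; 1F → xz ; 2F → xw })
                  (shadow-∷ (λ { 0F → yz ; 1F → yw }) (shadow-∷ (λ { 0F → zw }) (shadow-∷ (λ ()) (clique-[] {R = shadow}))))))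

          conflict : ∀ i j → i Fin.< j → ∀ {u} → IsEdge H u (V (source i)) (V (target i)) → IsEdge H u (V (source j)) (V (target j)) → ⊥
          conflict 0F 1F _ e e′ = cancellative e e′ (adjacent 1F 2F λ ())
          conflict 0F 2F _ e e′ = cancellative e e′ (adjacent 1F 3F λ ())
          conflict 0F 3F _ e e′ = cancellative (swap₂₃ e) e′ (adjacent 0F 2F λ ())
          conflict 0F 4F _ e e′ = cancellative (swap₂₃ e) e′ (adjacent 0F 3F λ ())
          conflict 1F 2F _ e e′ = cancellative e e′ (adjacent 2F 3F λ ())
          conflict 1F 3F _ e e′ = cancellative (swap₂₃ e) (swap₂₃ e′) (adjacent 0F 1F λ ())
          conflict 1F 4F _ e e′ = disjoint e e′ (adjacent 0F 2F λ ()) (adjacent 0F 1F λ ()) (adjacent 0F 3F λ ()) (adjacent 2F 1F λ ()) (adjacent 2F 3F λ ()) (adjacent 1F 3F λ ())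
          conflict 2F 3F _ e e′ = disjoint e e′ (adjacent 0F 3F λ ()) (adjacent 0F 1F λ ()) (adjacent 0F 2F λ ()) (adjacent 3F 1F λ ()) (adjacent 3F 2F λ ()) (adjacent 1F 2F λ ())
          conflict 2F 4F _ e e′ = cancellative (swap₂₃ e) (swap₂₃ e′) (adjacent 0F 1F λ ())
          conflict 3F 4F _ e e′ = cancellative e e′ (adjacent 2F 3F λ ())
          conflict _ 0F ()
          conflict 1F 1F (s≤s ())
          conflict 2F 1F (s≤s ())
          conflict 3F 1F (s≤s ())
          conflict 4F 1F (s≤s ())
          conflict 2F 2F (s≤s (s≤s ()))
          conflict 3F 2F (s≤s (s≤s ()))
          conflict 4F 2F (s≤s (s≤s ()))
          conflict 3F 3F (s≤s (s≤s (s≤s ())))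
          conflict 4F 3F (s≤s (s≤s (s≤s ())))
          conflict 4F 4F (s≤s (s≤s (s≤s (s≤s ()))))

      shadowGraph : K₄FreeGraph n
      shadowGraph .K₄FreeGraph.adj     = shadow
      shadowGraph .K₄FreeGraph.adj-sym = shadow-sym
      shadowGraph .K₄FreeGraph.no-K₄ {a} {b} {c} {d} ab ac ad bc bd cd =
        no-4-clique (a Vector.∷ b Vector.∷ c Vector.∷ d Vector.∷ Vector.[])
          (shadow-∷ (λ { 0F → ab ; 1F → ac ; 2F → ad }) (shadow-∷ (λ { 0F → bc ; 1F → bd }) (shadow-∷ (λ { 0F → cd }) (shadow-∷ (λ ()) (clique-[] {R = shadow})))))

      shadow-dense : Dense shadowGraph
      shadow-dense v = <-≤-trans (linkSize-large v) (*-monoʳ-≤ 45 (∑∑-mono-≤ pointwise))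
        where
        pointwise : ∀ x y → ⟦ edge H v x y ⟧ ≤ ⟦ shadow v x ∧ shadow v y ∧ shadow x y ⟧
        pointwise x y = ⟦⟧-mono λ e →
          cong₂ _∧_ (shadow-intro e) (cong₂ _∧_ (shadow-intro (swap₂₃ e)) (shadow-intro (swap₂₃ (swap₁₂ e))))

theorem1p2 : (n : ℕ) → 0 < n → (H : ThreeGraph n) → K4minusF5Free H →
    (∀ (v : Fin n) → 4 * (n * n) < 45 * degree H v) →
    ThreePartite H
-- All three pairs in an edge lie in the shadow, so a proper colouring of it separates them. The
-- vertex `zero` exists as n > 0 and starts the triangle from which the colour classes are defined.
theorem1p2 (suc n) _ H free large = part , λ a b c e →
  proper a b (shadow-intro H e) , proper b c (shadow-intro H (swap₂₃ H (swap₁₂ H e))) , proper a c (shadow-intro H (swap₂₃ H e))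
  where
  colouring = dense-colouring (shadowGraph H free large) zero (shadow-dense H free large)
  part = proj₁ colouring
  proper = proj₂ colouring
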